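{- For every prime power $q$, there exists a $(q-1)$-IPC$(q^2+1,q^2)$.
   Context: For permutations $\sigma,\tau$ of an $n$-element set, the Hamming distance is the number of points $x$ with $\sigma(x)\neq\tau(x)$. A permutation code PC$(n,d)$ is a set of permutations of an $n$-element set in which any two distinct elements are at Hamming distance at least $d$. A permutation code is idempotent if each of its words has exactly one fixed point. An $r$-IPC$(n,n-1)$ is an idempotent PC$(n,n-1)$ on an $n$-element symbol set in which every symbol is the fixed point of exactly $r$ words. -}

module Defs where

open import Data.Nat using (ℕ; suc; _≤_; _^_; _+_; _∸_)
open import Data.Nat.Primality using (Prime)
open import Data.Fin using (Fin)
open import Data.Fin.Properties using (_≟_)
open import Data.Fin.Permutation using (Permutation′; _⟨$⟩ʳ_)
open import Data.List using (List; length; filter; allFin; lookup)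
open import Data.Product using (Σ; _×_)
open import Relation.Binary.PropositionalEquality using (_≡_; _≢_)
open import Relation.Nullary using (¬?)

IsPrimePower : ℕ → Set
IsPrimePower q = Σ ℕ λ p → Σ ℕ λ k → Prime p × 1 ≤ k × q ≡ p ^ k

hamming : ∀ {n} → Permutation′ n → Permutation′ n → ℕ
hamming {n} σ τ = length (filter (λ x → ¬? ((σ ⟨$⟩ʳ x) ≟ (τ ⟨$⟩ʳ x))) (allFin n))

fixCount : ∀ {n} → Permutation′ n → ℕ
fixCount {n} σ = length (filter (λ x → (σ ⟨$⟩ʳ x) ≟ x) (allFin n))

fixersOf : ∀ {n} → List (Permutation′ n) → Fin n → ℕ
fixersOf C x = length (filter (λ σ → (σ ⟨$⟩ʳ x) ≟ x) C)

-- A code is given as a list of words; words at distinct positions are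
-- at Hamming distance at least d (for d ≥ 1 this forces distinct words,
-- so the list represents a set).
IsPC : (n d : ℕ) → List (Permutation′ n) → Set
IsPC n d C = ∀ (i j : Fin (length C)) → i ≢ j → d ≤ hamming (lookup C i) (lookup C j)

IsIdempotent : ∀ {n} → List (Permutation′ n) → Set
IsIdempotent C = ∀ (i : Fin (length C)) → fixCount (lookup C i) ≡ 1

IsIPC : (r n : ℕ) → List (Permutation′ n) → Set
IsIPC r n C = IsPC n (n ∸ 1) C × IsIdempotent C × (∀ (x : Fin n) → fixersOf C x ≡ r)

{-# OPTIONS --safe #-}

-- Let K be the field with q elements, choose d outside the image of y ↦ y (y + 1) (0 and -1 have the same
-- image, so this map is not onto), and let K² = K ⊕ Kθ with θ² = θ + d, a field with q² elements. The symbols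
-- are the elements u + vθ of K² and ∞. For s ∈ K* and b ∈ K², the affine map x ↦ (s + θ) x + b sends exactly
-- one point x₀ of the line v = s into the line v = s + 1; reroute x₀ ↦ ∞ ↦ (s + θ) x₀ + b. To these words add
-- the translations by t ∈ K*, fixing ∞. Affine maps of different slopes agree exactly once, and rerouting
-- creates no new agreement because the lines v = s differ for different s; those of the same slope never agree,
-- and agree at most once after rerouting. Each slope s + θ contributes one word fixing a given x ∈ K², and the
-- translations are the q - 1 words fixing ∞.
--
-- To construct K for q = pᵏ, let R = F_p[x]/(x^(q-1) - 1). By Frobenius every y ∈ R satisfies y^q = y. The
-- product e of the x^(pᵈ-1) - 1 for 0 < d < k is monic of degree less than q - 1, hence nonzero. Choose a nonzero
-- multiple ε of e such that every y divides ε or satisfies ε y = 0. Then K = R/Ann ε is a domain in which the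
-- conjugates x^(pⁱ), i < k, of x are distinct. So no nonzero polynomial of degree less than k over F_p vanishes at x,
-- which gives q elements of K, and there are no more because all are roots of y^q - y.
module Submission where

open import Defs
open import Algebra.Bundles using (CommutativeRing; RawRing)
open import Algebra.Core using (Op₁; Op₂)
open import Algebra.Morphism.Structures using (IsRingMonomorphism)
import Algebra.Morphism.RingMonomorphism as RingMonomorphism
open import Algebra.Structures using (IsCommutativeRing)
open import Data.Empty using (⊥-elim)
open import Data.Fin.Base as Fin using (Fin; zero; suc; toℕ; inject₁; fromℕ; fromℕ<; finToFun; funToFin; combine; punchIn; punchOut)
open import Data.Fin.Permutation using (Permutation′; _⟨$⟩ʳ_)
open import Data.Fin.Properties as Fin using (toℕ-inject₁; toℕ-fromℕ; toℕ-fromℕ<; toℕ<n; toℕ-injective; any?; all?; funToFin-finToFin;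
  finToFun-funToFin; punchOut-injective; punchIn-injective; punchInᵢ≢i; injective⇒≤; +↔⊎; *↔×; 1↔⊤)
open import Data.Integer.Base as ℤ using (ℤ; +_; 0ℤ; 1ℤ)
open import Data.Integer.DivMod using (_%ℕ_; _/ℕ_; a≡a%ℕn+[a/ℕn]*n; n%ℕd<d)
import Data.Integer.Divisibility.Signed as ℤ∣
import Data.Integer.Properties as ℤ
open import Data.List.Base using (List; []; _∷_; _++_; [_]; length; tabulate; replicate; filter; allFin; map; lookup)
open import Data.List.Membership.Propositional using (_∈_)
open import Data.List.Membership.Propositional.Properties using (∈-filter⁺; ∈-filter⁻; ∈-allFin; ∈-tabulate⁺; ∈-tabulate⁻; ∈-lookup)
open import Data.List.Membership.Propositional.Properties.WithK using (unique∧set⇒bag)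
open import Data.List.Properties using (length-tabulate; length-++; length-replicate; filter-all; map-tabulate)
open import Data.List.Relation.Binary.BagAndSetEquality using (∼bag⇒↭)
open import Data.List.Relation.Binary.Permutation.Propositional.Properties using (↭-length)
open import Data.List.Relation.Unary.All as All using (All; []; _∷_)
import Data.List.Relation.Unary.All.Properties as All
open import Data.List.Relation.Unary.AllPairs using (AllPairs; []; _∷_)
import Data.List.Relation.Unary.AllPairs.Properties as AllPairs
open import Data.List.Relation.Unary.Any using (Any; here; there)
import Data.List.Relation.Unary.Any.Properties as Any
open import Data.List.Relation.Unary.Unique.Propositional using (Unique)
import Data.List.Relation.Unary.Unique.Propositional.Properties as Unique
open import Data.Nat.Base as ℕ using (ℕ; zero; suc; _∸_; _<_; _≤_; s≤s; z≤n; _!)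
open import Data.Nat.Combinatorics using (_C_; k![n∸k]!∣n!; nCk≡n!/k![n-k]!; nCn≡1)
open import Data.Nat.Coprimality using (prime⇒coprime; coprime-Bézout)
import Data.Nat.Divisibility as ℕ
open import Data.Nat.DivMod using (m/n*n≡m)
open import Data.Nat.GCD using (module Bézout)
open import Data.Nat.Primality using (Prime; euclidsLemma; prime⇒nonTrivial)
import Data.Nat.Properties as ℕ
open import Data.Product.Base using (Σ; ∃; _,_; proj₁; proj₂; _×_)
open import Data.Product.Function.NonDependent.Propositional using (_×-↔_)
open import Data.Product.Properties using (≡-dec)
open import Data.Sum.Base as Sum using (_⊎_; inj₁; inj₂; [_,_]′)
open import Data.Sum.Function.Propositional using (_⊎-↔_)
open import Data.Sum.Properties using (inj₁-injective; inj₂-injective)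
open import Data.Unit.Base using (⊤; tt)
open import Function.Base using (_∘_; id)
open import Function.Bundles using (_↔_; Inverse; mk↔ₛ′; mk⇔)
open import Function.Definitions using (Injective)
open import Function.Properties.Inverse using (↔-trans; ↔-refl)
open import Level using (0ℓ)
open import Relation.Binary.Core using (Rel)
open import Relation.Binary.Definitions using (Decidable; DecidableEquality; Symmetric; _Respects_; tri<; tri≈; tri>)
open import Relation.Binary.PropositionalEquality as ≡ using (_≡_; _≢_; _≗_; cong; cong₂; subst)
open import Relation.Nullary using (¬_; ¬?; yes; no)
open import Relation.Unary using (Pred) renaming (Decidable to Decidable₁)

-- A ring solver with integer coefficients for any commutative ring.

module IntegerSolver {c ℓ} (R : CommutativeRing c ℓ) where

  open CommutativeRing R hiding (zero)
  open import Algebra.Properties.Ring ring using (-‿distribˡ-*; -0#≈0#; -‿involutive)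
  open import Algebra.Properties.AbelianGroup +-abelianGroup using (⁻¹-∙-comm)
  open import Algebra.Properties.Semiring.Mult.TCOptimised semiring using (1+×; ×-homo-+) renaming (_×_ to _·_)
  open import Algebra.Solver.Ring.AlmostCommutativeRing using (_-Raw-AlmostCommutative⟶_; fromCommutativeRing)
  open import Data.Integer.Base using (-[1+_]; _⊖_)
  open import Data.Maybe.Base as Maybe using (Maybe)
  open import Relation.Nullary.Decidable using (dec⇒maybe)
  open import Relation.Binary.Reasoning.Setoid setoid

  -- The canonical map from the integers. With the optimised multiples `1 · 1#` is `1#` by
  -- computation, so `con 1ℤ` in a solver equation means `1#` itself.
  ι : ℤ → Carrier
  ι (+ n)    = n · 1#
  ι -[1+ n ] = - (suc n · 1#)

  private
    x-0≈x : ∀ x → x - 0# ≈ x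
    x-0≈x x = trans (+-congˡ -0#≈0#) (+-identityʳ x)

    cancel : ∀ x y z → (x + y) - (x + z) ≈ y - z
    cancel x y z = begin
      (x + y) - (x + z)     ≈⟨ +-cong (+-comm x y) (sym (⁻¹-∙-comm x z)) ⟩
      (y + x) + (- x - z)   ≈⟨ +-assoc y x _ ⟩
      y + (x + (- x - z))   ≈⟨ +-congˡ (+-assoc x (- x) (- z)) ⟨
      y + ((x - x) - z)     ≈⟨ +-congˡ (+-congʳ (-‿inverseʳ x)) ⟩
      y + (0# - z)          ≈⟨ +-congˡ (+-identityˡ (- z)) ⟩
      y - z                 ∎

  ι-⊖ : ∀ m n → ι (m ⊖ n) ≈ m · 1# - n · 1#
  ι-⊖ zero    zero    = sym (x-0≈x 0#)
  ι-⊖ zero    (suc n) = sym (+-identityˡ _)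
  ι-⊖ (suc m) zero    = sym (x-0≈x _)
  ι-⊖ (suc m) (suc n) = begin
    ι (suc m ⊖ suc n)      ≡⟨ ≡.cong ι (ℤ.[1+m]⊖[1+n]≡m⊖n m n) ⟩
    ι (m ⊖ n)              ≈⟨ ι-⊖ m n ⟩
    m · 1# - n · 1#        ≈⟨ cancel 1# (m · 1#) (n · 1#) ⟨
    (1# + m · 1#) - (1# + n · 1#) ≈⟨ +-cong (1+× m 1#) (-‿cong (1+× n 1#)) ⟨
    suc m · 1# - suc n · 1# ∎

  ι-neg : ∀ i → ι (ℤ.- i) ≈ - ι i
  ι-neg (+ zero)  = sym -0#≈0#
  ι-neg (+ suc n) = refl
  ι-neg -[1+ n ]  = sym (-‿involutive _)

  ι-+ : ∀ i j → ι (i ℤ.+ j) ≈ ι i + ι j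
  ι-+ (+ m)    (+ n)    = ×-homo-+ 1# m n
  ι-+ (+ m)    -[1+ n ] = ι-⊖ m (suc n)
  ι-+ -[1+ m ] (+ n)    = trans (ι-⊖ n (suc m)) (+-comm _ _)
  ι-+ -[1+ m ] -[1+ n ] = begin
    - (suc (suc (m ℕ.+ n)) · 1#)       ≡⟨ ≡.cong (λ l → - (suc l · 1#)) (≡.sym (ℕ.+-suc m n)) ⟩
    - ((suc m ℕ.+ suc n) · 1#)         ≈⟨ -‿cong (×-homo-+ 1# (suc m) (suc n)) ⟩
    - (suc m · 1# + suc n · 1#)        ≈⟨ ⁻¹-∙-comm _ _ ⟨
    - (suc m · 1#) - suc n · 1#        ∎

  private
    ι-*-pos : ∀ m j → ι (+ m ℤ.* j) ≈ (m · 1#) * ι j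
    ι-*-pos zero    j = sym (zeroˡ (ι j))
    ι-*-pos (suc m) j = begin
      ι (+ suc m ℤ.* j)            ≡⟨ ≡.cong ι (ℤ.suc-* (+ m) j) ⟩
      ι (j ℤ.+ + m ℤ.* j)          ≈⟨ ι-+ j (+ m ℤ.* j) ⟩
      ι j + ι (+ m ℤ.* j)          ≈⟨ +-cong (sym (*-identityˡ (ι j))) (ι-*-pos m j) ⟩
      1# * ι j + (m · 1#) * ι j    ≈⟨ distribʳ (ι j) 1# (m · 1#) ⟨
      (1# + m · 1#) * ι j          ≈⟨ *-congʳ (1+× m 1#) ⟨
      (suc m · 1#) * ι j           ∎

  ι-* : ∀ i j → ι (i ℤ.* j) ≈ ι i * ι j
  ι-* (+ m)    j = ι-*-pos m j
  ι-* -[1+ m ] j = begin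
    ι (-[1+ m ] ℤ.* j)        ≡⟨ ≡.cong ι (ℤ.neg-distribˡ-* (+ suc m) j) ⟨
    ι (ℤ.- (+ suc m ℤ.* j))   ≈⟨ ι-neg (+ suc m ℤ.* j) ⟩
    - ι (+ suc m ℤ.* j)       ≈⟨ -‿cong (ι-*-pos (suc m) j) ⟩
    - ((suc m · 1#) * ι j)    ≈⟨ -‿distribˡ-* _ _ ⟩
    ι -[1+ m ] * ι j          ∎

  ι-homo : ℤ.+-*-rawRing -Raw-AlmostCommutative⟶ fromCommutativeRing R
  ι-homo = record
    { ⟦_⟧    = ι
    ; +-homo = ι-+
    ; *-homo = ι-*
    ; -‿homo = ι-neg
    ; 0-homo = refl
    ; 1-homo = refl
    }

  ι-≟ : ∀ i j → Maybe (ι i ≈ ι j)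
  ι-≟ i j = Maybe.map (λ { ≡.refl → refl }) (dec⇒maybe (i ℤ.≟ j))

  open import Algebra.Solver.Ring ℤ.+-*-rawRing (fromCommutativeRing R) ι-homo ι-≟ public
    using (solve; _:=_; _:+_; _:*_; _:-_; :-_; con)

-- Prime divisors of binomial coefficients and the Frobenius map.

prime>1 : ∀ {p} → Prime p → 1 < p
prime>1 pr = ℕ.nonTrivial⇒n>1 _ {{prime⇒nonTrivial pr}}

prime-power>1 : ∀ {p k} → Prime p → 0 < k → 1 < p ℕ.^ k
prime-power>1 {p} {suc k} pr _ = ℕ.<-≤-trans (prime>1 pr) (ℕ.m≤m*n p (p ℕ.^ k) {{ℕ.m^n≢0 p k {{nonZero}}}})
  where
  nonZero : ℕ.NonZero p
  nonZero = ℕ.>-nonZero (ℕ.<-trans (s≤s z≤n) (prime>1 pr))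

prime∤m! : ∀ {p} → Prime p → ∀ {m} → m < p → ¬ p ℕ.∣ m !
prime∤m! pr {zero} m<p d = ℕ.<-irrefl (≡.sym (ℕ.∣1⇒≡1 d)) (prime>1 pr)
prime∤m! pr {suc m} m<p d with euclidsLemma (suc m) (m !) pr d
... | inj₁ d′ = ℕ.<⇒≱ m<p (ℕ.∣⇒≤ d′)
... | inj₂ d′ = prime∤m! pr (ℕ.<-trans (ℕ.n<1+n m) m<p) d′

-- The prime divides `p ! = (p C k) * (k ! * (p ∸ k) !)`, but neither factorial on the right, since
-- both are of numbers below `p`.
prime∣pCk : ∀ {p} → Prime p → ∀ {k} → 0 < k → k < p → p ℕ.∣ p C k
prime∣pCk {p@(suc p-1)} pr {k} 0<k k<p with euclidsLemma (p C k) (k ! ℕ.* (p ∸ k) !) pr p∣product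
  where
  instance _ = k ℕ.!* (p ∸ k) !≢0
  pCk*k![p∸k]!≡p! : (p C k) ℕ.* (k ! ℕ.* (p ∸ k) !) ≡ p !
  pCk*k![p∸k]!≡p! = ≡.trans (cong (ℕ._* (k ! ℕ.* (p ∸ k) !)) (nCk≡n!/k![n-k]! (ℕ.<⇒≤ k<p))) (m/n*n≡m (k![n∸k]!∣n! (ℕ.<⇒≤ k<p)))
  p∣product : p ℕ.∣ (p C k) ℕ.* (k ! ℕ.* (p ∸ k) !)
  p∣product = subst (p ℕ.∣_) (≡.sym pCk*k![p∸k]!≡p!) (ℕ.m∣m*n (p-1 !))
... | inj₁ d = d
... | inj₂ d with euclidsLemma (k !) ((p ∸ k) !) pr d
...   | inj₁ d′ = ⊥-elim (prime∤m! pr k<p d′)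
...   | inj₂ d′ = ⊥-elim (prime∤m! pr (ℕ.∸-monoʳ-< 0<k (ℕ.<⇒≤ k<p)) d′)

module Frobenius {c ℓ} (R : CommutativeRing c ℓ) (p : ℕ) (prime : Prime p) where

  open CommutativeRing R hiding (zero)
  open import Algebra.Properties.Semiring.Mult semiring renaming (_×_ to _·_)
  open import Algebra.Properties.CommutativeSemiring.Exp commutativeSemiring
  open import Algebra.Properties.Semiring.Sum semiring using (sum; sum-cong-≋; sum-init-last; sum-replicate-zero)
  open import Algebra.Properties.CommutativeSemiring.Binomial commutativeSemiring using (theorem; binomialTerm)
  open import Relation.Binary.Reasoning.Setoid setoid

  module _ (char : p · 1# ≈ 0#) where

    p∣n⇒n×x≈0 : ∀ {n} → p ℕ.∣ n → ∀ x → n · x ≈ 0#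
    p∣n⇒n×x≈0 (ℕ.divides q ≡.refl) x = begin
      (q ℕ.* p) · x          ≈⟨ ×-congʳ (q ℕ.* p) (*-identityˡ x) ⟨
      (q ℕ.* p) · (1# * x)   ≈⟨ ×-assoc-* (q ℕ.* p) 1# x ⟨
      ((q ℕ.* p) · 1#) * x   ≈⟨ *-congʳ (×-assocˡ 1# q p) ⟨
      (q · (p · 1#)) * x     ≈⟨ *-congʳ (×-congʳ q char) ⟩
      (q · 0#) * x           ≈⟨ ×-assoc-* q 0# x ⟩
      q · (0# * x)           ≈⟨ ×-comm-* q 0# x ⟨
      0# * (q · x)           ≈⟨ zeroˡ _ ⟩
      0#                     ∎

    private
      -- In the binomial theorem only the two outer terms survive. Exposing `p` as `suc m` lets the
      -- sum split into its first term, `m` inner terms and its last term.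
      frob : ∀ m → p ≡ suc m → ∀ x y → (x + y) ^ p ≈ x ^ p + y ^ p
      frob m ≡.refl x y = begin
        (x + y) ^ p                                ≈⟨ theorem p x y ⟩
        t zero + sum (λ i → t (suc i))             ≈⟨ +-cong first rest ⟩
        y ^ p + x ^ p                              ≈⟨ +-comm _ _ ⟩
        x ^ p + y ^ p                              ∎
        where
        t : Fin (suc p) → Carrier
        t = binomialTerm x y p
        first : t zero ≈ y ^ p
        first = trans (×-homo-1 _) (*-identityˡ _)
        middle : ∀ i → t (suc (inject₁ i)) ≈ 0#
        middle i = p∣n⇒n×x≈0 (prime∣pCk prime (s≤s z≤n) (s≤s (subst (_< m) (≡.sym (toℕ-inject₁ i)) (toℕ<n i)))) _
        final : t (suc (fromℕ m)) ≈ x ^ p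
        final rewrite toℕ-fromℕ m | nCn≡1 p | ℕ.n∸n≡0 m = trans (×-homo-1 _) (*-identityʳ _)
        rest : sum (λ i → t (suc i)) ≈ x ^ p
        rest = begin
          sum (λ i → t (suc i))                                  ≈⟨ sum-init-last (λ i → t (suc i)) ⟩
          sum (λ i → t (suc (inject₁ i))) + t (suc (fromℕ m))    ≈⟨ +-cong (trans (sum-cong-≋ middle) (sum-replicate-zero m)) final ⟩
          0# + x ^ p                                             ≈⟨ +-identityˡ _ ⟩
          x ^ p                                                  ∎

    ^p-distrib-+ : ∀ x y → (x + y) ^ p ≈ x ^ p + y ^ p
    ^p-distrib-+ = frob (ℕ.pred p) (≡.sym (ℕ.suc-pred p {{ℕ.>-nonZero (ℕ.<-trans (s≤s z≤n) (prime>1 prime))}}))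

    ^pⁿ-distrib-+ : ∀ n x y → (x + y) ^ (p ℕ.^ n) ≈ x ^ (p ℕ.^ n) + y ^ (p ℕ.^ n)
    ^pⁿ-distrib-+ zero    x y = trans (*-identityʳ _) (sym (+-cong (*-identityʳ _) (*-identityʳ _)))
    ^pⁿ-distrib-+ (suc n) x y = begin
      (x + y) ^ (p ℕ.* p ℕ.^ n)                  ≈⟨ ^-assocʳ (x + y) p (p ℕ.^ n) ⟨
      ((x + y) ^ p) ^ (p ℕ.^ n)                  ≈⟨ ^-congˡ (p ℕ.^ n) (^p-distrib-+ x y) ⟩
      (x ^ p + y ^ p) ^ (p ℕ.^ n)                ≈⟨ ^pⁿ-distrib-+ n (x ^ p) (y ^ p) ⟩
      (x ^ p) ^ (p ℕ.^ n) + (y ^ p) ^ (p ℕ.^ n)  ≈⟨ +-cong (^-assocʳ x p (p ℕ.^ n)) (^-assocʳ y p (p ℕ.^ n)) ⟩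
      x ^ (p ℕ.^ suc n) + y ^ (p ℕ.^ suc n)      ∎

-- Polynomials over a domain of characteristic `p` and the count of its elements.

funToFin-cong : ∀ {m n} {f g : Fin m → Fin n} → f ≗ g → funToFin f ≡ funToFin g
funToFin-cong {zero}  f≗g = ≡.refl
funToFin-cong {suc m} f≗g = cong₂ combine (f≗g zero) (funToFin-cong (f≗g ∘ suc))

finToFun-injective : ∀ {m n} {i j : Fin (m ℕ.^ n)} → finToFun {m} {n} i ≗ finToFun j → i ≡ j
finToFun-injective {m} {n} {i} {j} eq =
  ≡.trans (≡.sym (funToFin-finToFin {n} {m} i)) (≡.trans (funToFin-cong {n} {m} eq) (funToFin-finToFin {n} {m} j))

-- On a finite carrier this is a field; invertibility enters the code only through cancellation.
-- Equality is propositional, so that elements can serve directly as symbols.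
record IntegralDomainOn (A : Set) : Set where
  infixl 6 _+_
  infixl 7 _*_
  field
    _+_ _*_           : Op₂ A
    -_                : Op₁ A
    0# 1#             : A
    isCommutativeRing : IsCommutativeRing _≡_ _+_ _*_ -_ 0# 1#
    1≢0               : 1# ≢ 0#
    integral          : ∀ x y → x * y ≡ 0# → x ≡ 0# ⊎ y ≡ 0#

  commutativeRing : CommutativeRing 0ℓ 0ℓ
  commutativeRing = record { isCommutativeRing = isCommutativeRing }

module Domain {c ℓ} (K : CommutativeRing c ℓ) where

  open CommutativeRing K hiding (zero)
  open IntegerSolver K
  open import Algebra.Properties.Ring ring using (x∙y⁻¹≈ε⇒x≈y; -0#≈0#; -‿involutive)
  open import Algebra.Properties.CommutativeSemiring.Exp commutativeSemiring
  open import Algebra.Properties.Semiring.Mult semiring using (×-homo-+; ×1-homo-*) renaming (_×_ to _·_)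
  open import Relation.Binary.Reasoning.Setoid setoid

  eval : List Carrier → Carrier → Carrier
  eval []       y = 0#
  eval (c ∷ cs) y = c + y * eval cs y

  eval-cong : ∀ cs {y z} → y ≈ z → eval cs y ≈ eval cs z
  eval-cong []       y≈z = refl
  eval-cong (c ∷ cs) y≈z = +-congˡ (*-cong y≈z (eval-cong cs y≈z))

  eval-tabulate-minus : ∀ {n} (a b : Fin n → Carrier) y →
    eval (tabulate (λ j → a j - b j)) y ≈ eval (tabulate a) y - eval (tabulate b) y
  eval-tabulate-minus {zero}  a b y = sym (-‿inverseʳ 0#)
  eval-tabulate-minus {suc n} a b y = begin
    (a zero - b zero) + y * eval (tabulate (λ j → a (suc j) - b (suc j))) y
      ≈⟨ +-congˡ (*-congˡ (eval-tabulate-minus (a ∘ suc) (b ∘ suc) y)) ⟩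
    (a zero - b zero) + y * (A - B)
      ≈⟨ solve 5 (λ a₀ b₀ y A B → (a₀ :- b₀) :+ y :* (A :- B) := (a₀ :+ y :* A) :- (b₀ :+ y :* B)) refl (a zero) (b zero) y A B ⟩
    (a zero + y * A) - (b zero + y * B) ∎
    where
    A = eval (tabulate (a ∘ suc)) y
    B = eval (tabulate (b ∘ suc)) y

  -- The coefficients of (P(y) - P(a)) / (y - a) for P = c ∷ cs, which do not depend on c.
  quot : Carrier → List Carrier → List Carrier
  quot a []       = []
  quot a (c ∷ cs) = eval (c ∷ cs) a ∷ quot a cs

  length-quot : ∀ a cs → length (quot a cs) ≡ length cs
  length-quot a []       = ≡.refl
  length-quot a (c ∷ cs) = cong suc (length-quot a cs)

  eval-quot : ∀ a c cs y → eval (c ∷ cs) y ≈ eval (c ∷ cs) a + (y - a) * eval (quot a cs) y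
  eval-quot a c [] y = solve 3 (λ a c y → c :+ y :* con 0ℤ := (c :+ a :* con 0ℤ) :+ (y :- a) :* con 0ℤ) refl a c y
  eval-quot a c (d ∷ ds) y = begin
    c + y * eval (d ∷ ds) y
      ≈⟨ +-congˡ (*-congˡ (eval-quot a d ds y)) ⟩
    c + y * (P + (y - a) * Q)
      ≈⟨ solve 5 (λ a c y P Q → c :+ y :* (P :+ (y :- a) :* Q) := (c :+ a :* P) :+ (y :- a) :* (P :+ y :* Q)) refl a c y P Q ⟩
    (c + a * P) + (y - a) * (P + y * Q) ∎
    where
    P = eval (d ∷ ds) a
    Q = eval (quot a ds) y

  -- The entries of `quot a cs` are the values at `a` of the suffixes of `cs`, and each coefficient
  -- is one such value minus `a` times the next.
  quot≈0⇒≈0 : ∀ a cs → All (_≈ 0#) (quot a cs) → All (_≈ 0#) cs × eval cs a ≈ 0#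
  quot≈0⇒≈0 a []       []       = [] , refl
  quot≈0⇒≈0 a (c ∷ cs) (e ∷ es) with quot≈0⇒≈0 a cs es
  ... | cs≈0 , eval≈0 = trans (sym (trans (+-congˡ (trans (*-congˡ eval≈0) (zeroʳ a))) (+-identityʳ c))) e ∷ cs≈0 , e

  module _ (integral : ∀ x y → x * y ≈ 0# → x ≈ 0# ⊎ y ≈ 0#) where

    -- Divide by `y - r` for the first root `r`: in a domain the other roots, being different from
    -- `r`, are roots of the quotient, which has one coefficient fewer. Induction makes the quotient
    -- zero.
    roots-bound : ∀ cs rs → length cs ≤ length rs → AllPairs _≉_ rs →
                  All (λ r → eval cs r ≈ 0#) rs → All (_≈ 0#) cs
    roots-bound []       rs       len     distinct      roots = []
    roots-bound (c ∷ cs) (r ∷ rs) (s≤s len) (r≉ ∷ distinct) (root ∷ roots) = c≈0 ∷ proj₁ tail≈0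
      where
      quotient-root : ∀ {s} → r ≉ s → eval (c ∷ cs) s ≈ 0# → eval (quot r cs) s ≈ 0#
      quotient-root {s} r≉s e with integral (s - r) (eval (quot r cs) s) (begin
        (s - r) * Q                       ≈⟨ +-identityˡ _ ⟨
        0# + (s - r) * Q                  ≈⟨ +-congʳ root ⟨
        eval (c ∷ cs) r + (s - r) * Q     ≈⟨ eval-quot r c cs s ⟨
        eval (c ∷ cs) s                   ≈⟨ e ⟩
        0#                                ∎)
        where Q = eval (quot r cs) s
      ... | inj₁ s-r≈0 = ⊥-elim (r≉s (sym (x∙y⁻¹≈ε⇒x≈y s r s-r≈0)))
      ... | inj₂ Q≈0   = Q≈0
      tail≈0 = quot≈0⇒≈0 r cs (roots-bound (quot r cs) rs (subst (_≤ length rs) (≡.sym (length-quot r cs)) len) distinct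
                 (All.zipWith (λ (r≉s , e) → quotient-root r≉s e) (r≉ , roots)))
      c≈0 : c ≈ 0#
      c≈0 = trans (sym (trans (+-congˡ (trans (*-congˡ (proj₂ tail≈0)) (zeroʳ r))) (+-identityʳ c))) root

    module _ (1≉0 : 1# ≉ 0#) (p : ℕ) (prime : Prime p) (char : p · 1# ≈ 0#)
             (k : ℕ) (0<k : 0 < k)
             (x : Carrier) (x-generic : ∀ d → 0 < d → d < k → x ^ (p ℕ.^ d) ≉ x)
             (y^q≈y : ∀ y → y ^ (p ℕ.^ k) ≈ y)
             (_≈?_ : Decidable _≈_)
             where

      private
        q = p ℕ.^ k
        open Frobenius K p prime

      -- Since `n` and `p` are coprime, a Bézout identity would turn `n · 1# ≈ 0#` and `p · 1# ≈ 0#`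
      -- into `1# ≈ 0#`.
      n·1≉0 : ∀ n → 0 < n → n < p → n · 1# ≉ 0#
      n·1≉0 n 0<n n<p n·1≈0 with coprime-Bézout (prime⇒coprime prime {{ℕ.>-nonZero 0<n}} n<p)
      ... | Bézout.+- u v eq = 1≉0 (begin
        1#                        ≈⟨ +-identityʳ 1# ⟨
        1# + 0#                   ≈⟨ +-congˡ (trans (×1-homo-* v n) (trans (*-congˡ n·1≈0) (zeroʳ _))) ⟨
        1# + (v ℕ.* n) · 1#       ≡⟨⟩
        (1 ℕ.+ v ℕ.* n) · 1#      ≡⟨ cong (_· 1#) eq ⟩
        (u ℕ.* p) · 1#            ≈⟨ trans (×1-homo-* u p) (trans (*-congˡ char) (zeroʳ _)) ⟩
        0#                        ∎)
      ... | Bézout.-+ u v eq = 1≉0 (begin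
        1#                        ≈⟨ +-identityʳ 1# ⟨
        1# + 0#                   ≈⟨ +-congˡ (trans (×1-homo-* u p) (trans (*-congˡ char) (zeroʳ _))) ⟨
        1# + (u ℕ.* p) · 1#       ≡⟨⟩
        (1 ℕ.+ u ℕ.* p) · 1#      ≡⟨ cong (_· 1#) eq ⟩
        (v ℕ.* n) · 1#            ≈⟨ trans (×1-homo-* v n) (trans (*-congˡ n·1≈0) (zeroʳ _)) ⟩
        0#                        ∎)

      private
        ·1-injective-< : ∀ {m n} → m < n → n < p → m · 1# ≉ n · 1#
        ·1-injective-< {m} {n} m<n n<p eq = n·1≉0 (n ∸ m) (ℕ.m<n⇒0<n∸m m<n) (ℕ.≤-<-trans (ℕ.m∸n≤m n m) n<p) (begin
          (n ∸ m) · 1#                          ≈⟨ solve 2 (λ a b → b := (a :+ b) :- a) refl (m · 1#) _ ⟩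
          (m · 1# + (n ∸ m) · 1#) - m · 1#      ≈⟨ +-congʳ (×-homo-+ 1# m (n ∸ m)) ⟨
          (m ℕ.+ (n ∸ m)) · 1# - m · 1#         ≡⟨ cong (λ l → l · 1# - m · 1#) (ℕ.m+[n∸m]≡n (ℕ.<⇒≤ m<n)) ⟩
          n · 1# - m · 1#                       ≈⟨ +-congʳ eq ⟨
          m · 1# - m · 1#                       ≈⟨ -‿inverseʳ _ ⟩
          0#                                    ∎)

      ·1-injective : ∀ {m n} → m < p → n < p → m · 1# ≈ n · 1# → m ≡ n
      ·1-injective {m} {n} m<p n<p eq with ℕ.<-cmp m n
      ... | tri< m<n _ _ = ⊥-elim (·1-injective-< m<n n<p eq)
      ... | tri≈ _ m≡n _ = m≡n
      ... | tri> _ _ n<m = ⊥-elim (·1-injective-< n<m m<p (sym eq))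

      private
        0<p : 0 < p
        0<p = ℕ.<-trans (s≤s z≤n) (prime>1 prime)

        0^n≈0 : ∀ {n} → 0 < n → 0# ^ n ≈ 0#
        0^n≈0 {suc n} _ = zeroˡ _

        1^n≈1 : ∀ n → 1# ^ n ≈ 1#
        1^n≈1 zero    = refl
        1^n≈1 (suc n) = trans (*-identityˡ _) (1^n≈1 n)

      -- Fermat's little theorem, by induction from the additivity of Frobenius.
      [n·1]^p≈n·1 : ∀ n → (n · 1#) ^ p ≈ n · 1#
      [n·1]^p≈n·1 zero    = 0^n≈0 0<p
      [n·1]^p≈n·1 (suc n) = trans (^p-distrib-+ char 1# (n · 1#)) (+-cong (1^n≈1 p) ([n·1]^p≈n·1 n))

      ^p-minus : ∀ {a b} → a ^ p ≈ a → b ^ p ≈ b → (a - b) ^ p ≈ a - b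
      ^p-minus {a} {b} a^p b^p = begin
        (a - b) ^ p                      ≈⟨ solve 2 (λ u v → u := (u :+ v) :- v) refl ((a - b) ^ p) (b ^ p) ⟩
        (a - b) ^ p + b ^ p - b ^ p      ≈⟨ +-congʳ (^p-distrib-+ char (a - b) b) ⟨
        ((a - b) + b) ^ p - b ^ p        ≈⟨ +-cong (trans (^-congˡ p (solve 2 (λ a b → (a :- b) :+ b := a) refl a b)) a^p) (-‿cong b^p) ⟩
        a - b                            ∎

      -- Frobenius is a ring endomorphism that fixes these coefficients, so it commutes with
      -- evaluation and carries roots to roots.
      eval-^p : ∀ cs y → All (λ c → c ^ p ≈ c) cs → eval cs (y ^ p) ≈ eval cs y ^ p
      eval-^p []       y []       = sym (0^n≈0 0<p)
      eval-^p (c ∷ cs) y (e ∷ es) = begin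
        c + y ^ p * eval cs (y ^ p)      ≈⟨ +-cong (sym e) (*-congˡ (eval-^p cs y es)) ⟩
        c ^ p + y ^ p * eval cs y ^ p    ≈⟨ +-congˡ (^-distrib-* y (eval cs y) p) ⟨
        c ^ p + (y * eval cs y) ^ p      ≈⟨ ^p-distrib-+ char c (y * eval cs y) ⟨
        (c + y * eval cs y) ^ p          ∎

      eval-conjugate : ∀ cs → All (λ c → c ^ p ≈ c) cs → eval cs x ≈ 0# → ∀ j → eval cs (x ^ (p ℕ.^ j)) ≈ 0#
      eval-conjugate cs es e zero    = trans (eval-cong cs (*-identityʳ x)) e
      eval-conjugate cs es e (suc j) = begin
        eval cs (x ^ (p ℕ.* p ℕ.^ j))    ≡⟨ cong (λ n → eval cs (x ^ n)) (ℕ.*-comm p (p ℕ.^ j)) ⟩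
        eval cs (x ^ (p ℕ.^ j ℕ.* p))    ≈⟨ eval-cong cs (^-assocʳ x (p ℕ.^ j) p) ⟨
        eval cs ((x ^ (p ℕ.^ j)) ^ p)    ≈⟨ eval-^p cs (x ^ (p ℕ.^ j)) es ⟩
        eval cs (x ^ (p ℕ.^ j)) ^ p      ≈⟨ ^-congˡ p (eval-conjugate cs es e j) ⟩
        0# ^ p                           ≈⟨ 0^n≈0 0<p ⟩
        0#                               ∎

      -- Raising x ^ pⁱ ≈ x ^ pʲ to the power p ^ (k - i) gives x ≈ x ^ p ^ (j - i).
      conjugates-distinct-< : ∀ {i j} → i < j → j < k → x ^ (p ℕ.^ i) ≉ x ^ (p ℕ.^ j)
      conjugates-distinct-< {i} {j} i<j j<k eq = x-generic (j ∸ i) (ℕ.m<n⇒0<n∸m i<j) (ℕ.≤-<-trans (ℕ.m∸n≤m j i) j<k) (begin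
        x ^ (p ℕ.^ (j ∸ i))                           ≈⟨ y^q≈y _ ⟨
        (x ^ (p ℕ.^ (j ∸ i))) ^ q                     ≈⟨ power (j ∸ i) k ⟩
        x ^ (p ℕ.^ ((j ∸ i) ℕ.+ k))                   ≡⟨ cong (λ n → x ^ (p ℕ.^ n)) exponent ⟩
        x ^ (p ℕ.^ (j ℕ.+ (k ∸ i)))                   ≈⟨ power j (k ∸ i) ⟨
        (x ^ (p ℕ.^ j)) ^ (p ℕ.^ (k ∸ i))             ≈⟨ ^-congˡ (p ℕ.^ (k ∸ i)) eq ⟨
        (x ^ (p ℕ.^ i)) ^ (p ℕ.^ (k ∸ i))             ≈⟨ power i (k ∸ i) ⟩
        x ^ (p ℕ.^ (i ℕ.+ (k ∸ i)))                   ≡⟨ cong (λ n → x ^ (p ℕ.^ n)) (ℕ.m+[n∸m]≡n i≤k) ⟩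
        x ^ q                                         ≈⟨ y^q≈y x ⟩
        x                                             ∎)
        where
        i≤k = ℕ.<⇒≤ (ℕ.<-trans i<j j<k)
        power : ∀ m n → (x ^ (p ℕ.^ m)) ^ (p ℕ.^ n) ≈ x ^ (p ℕ.^ (m ℕ.+ n))
        power m n = trans (^-assocʳ x (p ℕ.^ m) (p ℕ.^ n)) (^-congʳ x (≡.sym (ℕ.^-distribˡ-+-* p m n)))
        exponent : (j ∸ i) ℕ.+ k ≡ j ℕ.+ (k ∸ i)
        exponent = ≡.trans (≡.sym (ℕ.+-∸-comm k (ℕ.<⇒≤ i<j))) (ℕ.+-∸-assoc j i≤k)

      -- The polynomials in `x` of degree below `k` with coefficients in the prime field; the
      -- coefficients are the `k` base-`p` digits of the index.
      element : Fin q → Carrier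
      element i = eval (tabulate (λ j → toℕ (finToFun {p} {k} i j) · 1#)) x

      -- If two such polynomials agree at `x`, their difference has coefficients fixed by Frobenius,
      -- hence vanishes at all `k` conjugates of `x`. These are distinct and there are only `k`
      -- coefficients, so all of them are zero.
      element-injective : ∀ {i j} → element i ≈ element j → i ≡ j
      element-injective {i} {j} eq = finToFun-injective {p} {k} λ l →
        toℕ-injective (·1-injective (toℕ<n (a l)) (toℕ<n (b l)) (x∙y⁻¹≈ε⇒x≈y _ _ (All.tabulate⁻ coefficients≈0 l)))
        where
        a = finToFun {p} {k} i
        b = finToFun {p} {k} j
        coefficients : List Carrier
        coefficients = tabulate (λ l → toℕ (a l) · 1# - toℕ (b l) · 1#)
        root : eval coefficients x ≈ 0#
        root = trans (eval-tabulate-minus (λ l → toℕ (a l) · 1#) (λ l → toℕ (b l) · 1#) x) (trans (+-congʳ eq) (-‿inverseʳ _))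
        conjugates = tabulate {n = k} (λ l → x ^ (p ℕ.^ toℕ l))
        coefficients≈0 : All (_≈ 0#) coefficients
        coefficients≈0 = roots-bound coefficients conjugates
          (ℕ.≤-reflexive (≡.trans (length-tabulate _) (≡.sym (length-tabulate {n = k} _))))
          (AllPairs.tabulate⁺-< (λ {u} {v} u<v → conjugates-distinct-< u<v (toℕ<n v)))
          (All.tabulate⁺ (λ l → eval-conjugate coefficients
            (All.tabulate⁺ (λ u → ^p-minus ([n·1]^p≈n·1 (toℕ (a u))) ([n·1]^p≈n·1 (toℕ (b u))))) root (toℕ l)))

      private
        1<q : 1 < q
        1<q = prime-power>1 prime 0<k

        eval-monomial : ∀ m y → eval (replicate m 0# ++ [ 1# ]) y ≈ y ^ m
        eval-monomial zero    y = trans (+-congˡ (zeroʳ y)) (+-identityʳ 1#)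
        eval-monomial (suc m) y = trans (+-identityˡ _) (*-congˡ (eval-monomial m y))

        length-monomial : ∀ m → length (replicate m 0# ++ [ 1# ]) ≡ suc m
        length-monomial m = ≡.trans (length-++ (replicate m 0#)) (≡.trans (cong (ℕ._+ 1) (length-replicate m)) (ℕ.+-comm m 1))

        -- Everything is a root of `y ^ q - y`, whose `q + 1` coefficients are listed here with
        -- `q = m + 2`. With `q + 1` distinct roots its coefficient `-1` at `y` would vanish.
        at-most : ∀ m → q ≡ suc (suc m) → ∀ rs → AllPairs _≉_ rs → ¬ suc q ≤ length rs
        at-most m q≡ rs distinct len with roots-bound (0# ∷ - 1# ∷ (replicate m 0# ++ [ 1# ])) rs
          (ℕ.≤-trans (ℕ.≤-reflexive (≡.trans (cong (2 ℕ.+_) (length-monomial m)) (cong suc (≡.sym q≡)))) len)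
          distinct
          (All.universal (λ y → begin
            0# + y * (- 1# + y * eval (replicate m 0# ++ [ 1# ]) y)   ≈⟨ +-congˡ (*-congˡ (+-congˡ (*-congˡ (eval-monomial m y)))) ⟩
            0# + y * (- 1# + y * y ^ m)    ≈⟨ solve 2 (λ y z → con 0ℤ :+ y :* (:- con 1ℤ :+ y :* z) := y :* (y :* z) :- y) refl y (y ^ m) ⟩
            y ^ suc (suc m) - y            ≡⟨ cong (λ n → y ^ n - y) q≡ ⟨
            y ^ q - y                      ≈⟨ +-congʳ (y^q≈y y) ⟩
            y - y                          ≈⟨ -‿inverseʳ y ⟩
            0#                             ∎) rs)
        ... | _ ∷ -1≈0 ∷ _ = 1≉0 (trans (sym (-‿involutive 1#)) (trans (-‿cong -1≈0) -0#≈0#))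

      element-surjective : ∀ y → ∃ λ i → element i ≈ y
      element-surjective y with any? (λ i → element i ≈? y)
      ... | yes hit = hit
      ... | no miss = ⊥-elim (at-most (q ∸ 2) (≡.sym (ℕ.m+[n∸m]≡n 1<q)) (y ∷ tabulate element)
        (All.tabulate⁺ (λ i y≈ → miss (i , sym y≈)) ∷ AllPairs.tabulate⁺ (λ i≢j eq → i≢j (element-injective eq)))
        (s≤s (ℕ.≤-reflexive (≡.sym (length-tabulate element)))))

      private
        index : Carrier → Fin q
        index y = proj₁ (element-surjective y)

        element-index : ∀ y → element (index y) ≈ y
        element-index y = proj₂ (element-surjective y)

        -- The structure is transported along `element`, which replaces the setoid equality by `_≡_`
        -- on `Fin q`; the ring laws then pull back along the monomorphism.
        finRing : RawRing 0ℓ 0ℓ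
        finRing = record
          { Carrier = Fin q
          ; _≈_ = _≡_
          ; _+_ = λ i j → index (element i + element j)
          ; _*_ = λ i j → index (element i * element j)
          ; -_  = λ i → index (- element i)
          ; 0#  = index 0#
          ; 1#  = index 1#
          }

        monomorphism : IsRingMonomorphism finRing rawRing element
        monomorphism = record
          { isRingHomomorphism = record
            { isSemiringHomomorphism = record
              { isNearSemiringHomomorphism = record
                { +-isMonoidHomomorphism = record
                  { isMagmaHomomorphism = record
                    { isRelHomomorphism = record { cong = λ { ≡.refl → refl } }
                    ; homo = λ i j → element-index _
                    }
                  ; ε-homo = element-index _
                  }
                ; *-homo = λ i j → element-index _
                }
              ; 1#-homo = element-index _
              }
            ; -‿homo = λ i → element-index _
            }
          ; injective = element-injective
          }

      integralDomainOnFin : IntegralDomainOn (Fin q)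
      integralDomainOnFin = record
        { isCommutativeRing = RingMonomorphism.isCommutativeRing monomorphism isCommutativeRing
        ; 1≢0      = λ eq → 1≉0 (trans (sym (element-index 1#)) (trans (reflexive (cong element eq)) (element-index 0#)))
        ; integral = λ i j eq → [ inj₁ ∘ isZero , inj₂ ∘ isZero ]′ (integral (element i) (element j)
            (trans (sym (element-index _)) (trans (reflexive (cong element eq)) (element-index 0#))))
        }
        where
        isZero : ∀ {i} → element i ≈ 0# → i ≡ index 0#
        isZero e = element-injective (trans e (sym (element-index 0#)))

-- Quotient rings and the domain obtained by dividing out an annihilator.

module Quotient {c ℓ i} (R : CommutativeRing c ℓ) (I : Pred (CommutativeRing.Carrier R) i) where

  open CommutativeRing R
  open IntegerSolver R

  module _ (I-resp : I Respects _≈_) (0∈I : I 0#)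
           (+-closed : ∀ {x y} → I x → I y → I (x + y))
           (*-closed : ∀ a {x} → I x → I (a * x))
           where

    infix 4 _~_
    _~_ : Rel Carrier i
    x ~ y = I (x - y)

    ≈⇒~ : ∀ {x y} → x ≈ y → x ~ y
    ≈⇒~ {x} {y} x≈y = I-resp (sym (trans (+-congʳ x≈y) (-‿inverseʳ y))) 0∈I

    quotientRing : CommutativeRing c i
    quotientRing = record
      { Carrier = Carrier
      ; _≈_ = _~_
      ; _+_ = _+_
      ; _*_ = _*_
      ; -_  = -_
      ; 0#  = 0#
      ; 1#  = 1#
      ; isCommutativeRing = record
        { isRing = record
          { +-isAbelianGroup = record
            { isGroup = record
              { isMonoid = record
                { isSemigroup = record
                  { isMagma = record
                    { isEquivalence = record
                      { refl  = ≈⇒~ refl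
                      ; sym   = λ {x} {y} x~y → I-resp (solve 2 (λ x y → :- con 1ℤ :* (x :- y) := y :- x) refl x y) (*-closed (- 1#) x~y)
                      ; trans = λ {x} {y} {z} x~y y~z → I-resp (solve 3 (λ x y z → (x :- y) :+ (y :- z) := x :- z) refl x y z) (+-closed x~y y~z)
                      }
                    ; ∙-cong = λ {x} {y} {u} {v} x~y u~v →
                        I-resp (solve 4 (λ x y u v → (x :- y) :+ (u :- v) := (x :+ u) :- (y :+ v)) refl x y u v) (+-closed x~y u~v)
                    }
                  ; assoc = λ x y z → ≈⇒~ (+-assoc x y z)
                  }
                ; identity = ≈⇒~ ∘ +-identityˡ , ≈⇒~ ∘ +-identityʳ
                }
              ; inverse = ≈⇒~ ∘ -‿inverseˡ , ≈⇒~ ∘ -‿inverseʳ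
              ; ⁻¹-cong = λ {x} {y} x~y → I-resp (solve 2 (λ x y → :- con 1ℤ :* (x :- y) := :- x :- :- y) refl x y) (*-closed (- 1#) x~y)
              }
            ; comm = λ x y → ≈⇒~ (+-comm x y)
            }
          ; *-cong = λ {x} {y} {u} {v} x~y u~v →
              I-resp (solve 4 (λ x y u v → u :* (x :- y) :+ y :* (u :- v) := x :* u :- y :* v) refl x y u v)
                     (+-closed (*-closed u x~y) (*-closed y u~v))
          ; *-assoc = λ x y z → ≈⇒~ (*-assoc x y z)
          ; *-identity = ≈⇒~ ∘ *-identityˡ , ≈⇒~ ∘ *-identityʳ
          ; distrib = (λ x y z → ≈⇒~ (distribˡ x y z)) , (λ x y z → ≈⇒~ (distribʳ x y z))
          }
        ; *-comm = λ x y → ≈⇒~ (*-comm x y)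
        }
      }

module ReducedQuotient {c ℓ} (R : CommutativeRing c ℓ) where

  open CommutativeRing R
  open IntegerSolver R
  open import Algebra.Properties.CommutativeSemiring.Exp commutativeSemiring
  open import Algebra.Properties.Ring ring using (-0#≈0#)
  open import Algebra.Properties.Semiring.Divisibility semiring using (_∣_; _,_; ∣-refl; ∣-trans)
  open import Relation.Binary.Reasoning.Setoid setoid

  module _ (_≈?_ : Decidable _≈_) where

    -- Run through `ys`, multiplying `e` by `y` whenever the product is nonzero. A `y` that was
    -- taken divides the result, and a `y` that was skipped annihilates `e` and so all later
    -- multiples. With all elements listed, the result generates a minimal nonzero ideal.
    saturate : ∀ (ys : List Carrier) e → e ≉ 0# →
      ∃ λ ε → ε ≉ 0# × e ∣ ε × All (λ y → ε * y ≈ 0# ⊎ y ∣ ε) ys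
    saturate []       e e≉0 = e , e≉0 , ∣-refl , []
    saturate (y ∷ ys) e e≉0 with (e * y) ≈? 0#
    ... | yes ey≈0 with saturate ys e e≉0
    ...   | ε , ε≉0 , (a , ae≈ε) , ps = ε , ε≉0 , (a , ae≈ε) , inj₁ (begin
            ε * y         ≈⟨ *-congʳ ae≈ε ⟨
            (a * e) * y   ≈⟨ *-assoc a e y ⟩
            a * (e * y)   ≈⟨ *-congˡ ey≈0 ⟩
            a * 0#        ≈⟨ zeroʳ a ⟩
            0#            ∎) ∷ ps
    saturate (y ∷ ys) e e≉0 | no ey≉0 with saturate ys (e * y) ey≉0
    ...   | ε , ε≉0 , ey∣ε , ps = ε , ε≉0 , ∣-trans (y , *-comm y e) ey∣ε , inj₂ (∣-trans (e , refl) ey∣ε) ∷ ps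

    maximalMultiple : ∀ ys → (∀ y → Any (y ≈_) ys) → ∀ e → e ≉ 0# →
      ∃ λ ε → ε ≉ 0# × e ∣ ε × (∀ y → ε * y ≈ 0# ⊎ y ∣ ε)
    maximalMultiple ys complete e e≉0 with saturate ys e e≉0
    ... | ε , ε≉0 , e∣ε , ps = ε , ε≉0 , e∣ε , λ y → find (complete y) ps
      where
      find : ∀ {y zs} → Any (y ≈_) zs → All (λ z → ε * z ≈ 0# ⊎ z ∣ ε) zs → ε * y ≈ 0# ⊎ y ∣ ε
      find (here y≈z) (p ∷ _)  = Sum.map (trans (*-congˡ y≈z)) (λ (a , az≈ε) → a , trans (*-congˡ y≈z) az≈ε) p
      find (there i)  (_ ∷ ps) = find i ps

    -- A divisor u of ε cancels from ε u v = 0 because u^(2+n) = u, so the quotient by Ann ε is a domain.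
    module _ (ε : Carrier) (ε≉0 : ε ≉ 0#) (dichotomy : ∀ y → ε * y ≈ 0# ⊎ y ∣ ε)
             (n : ℕ) (y^[2+n]≈y : ∀ y → y ^ (2 ℕ.+ n) ≈ y)
             where

      private
        ε*0≈0 : ε * 0# ≈ 0#
        ε*0≈0 = zeroʳ ε

        cancel : ∀ {u} v → u ∣ ε → ε * (u * v) ≈ 0# → ε * v ≈ 0#
        cancel {u} v (w , wu≈ε) εuv≈0 = begin
          ε * v                          ≈⟨ *-congʳ wu≈ε ⟨
          (w * u) * v                    ≈⟨ *-congʳ (*-congˡ (y^[2+n]≈y u)) ⟨
          (w * (u * (u * u ^ n))) * v    ≈⟨ solve 4 (λ u v w z → (w :* (u :* (u :* z))) :* v := z :* ((w :* u) :* (u :* v))) refl u v w (u ^ n) ⟩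
          u ^ n * ((w * u) * (u * v))    ≈⟨ *-congˡ (*-congʳ wu≈ε) ⟩
          u ^ n * (ε * (u * v))          ≈⟨ *-congˡ εuv≈0 ⟩
          u ^ n * 0#                     ≈⟨ zeroʳ (u ^ n) ⟩
          0#                             ∎

      open Quotient R (λ y → ε * y ≈ 0#) using (quotientRing)

      domain : CommutativeRing c ℓ
      domain = quotientRing
        (λ x≈y → trans (*-congˡ (sym x≈y)))
        ε*0≈0
        (λ {x} {y} x∈ y∈ → trans (distribˡ ε x y) (trans (+-cong x∈ y∈) (+-identityˡ 0#)))
        (λ a {x} x∈ → trans (solve 3 (λ ε a x → ε :* (a :* x) := a :* (ε :* x)) refl ε a x) (trans (*-congˡ x∈) (zeroʳ a)))

      private
        module D = CommutativeRing domain

      ≈⇒≈ᴰ : ∀ {x y} → x ≈ y → x D.≈ y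
      ≈⇒≈ᴰ {x} {y} x≈y = trans (*-congˡ (trans (+-congʳ x≈y) (-‿inverseʳ y))) ε*0≈0

      private
        ≈ᴰ0⇒ε* : ∀ {x} → x D.≈ 0# → ε * x ≈ 0#
        ≈ᴰ0⇒ε* {x} = trans (*-congˡ (sym (trans (+-congˡ -0#≈0#) (+-identityʳ x))))

        ε*⇒≈ᴰ0 : ∀ {x} → ε * x ≈ 0# → x D.≈ 0#
        ε*⇒≈ᴰ0 {x} = trans (*-congˡ (trans (+-congˡ -0#≈0#) (+-identityʳ x)))

      domain-≈? : Decidable D._≈_
      domain-≈? x y = (ε * (x - y)) ≈? 0#

      -- Cancelling `u` from `ε * u ≈ 0#` would leave `ε ≈ 0#`. This keeps prescribed elements
      -- nonzero in the quotient: it suffices that `ε` is a multiple of them.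
      divisor≉0 : ∀ {u} → u ∣ ε → u D.≉ 0#
      divisor≉0 {u} u∣ε u≈0 = ε≉0 (trans (sym (*-identityʳ ε))
        (cancel 1# u∣ε (trans (*-congˡ (*-identityʳ u)) (≈ᴰ0⇒ε* u≈0))))

      domain-integral : ∀ x y → x * y D.≈ 0# → x D.≈ 0# ⊎ y D.≈ 0#
      domain-integral x y xy≈0 = Sum.map ε*⇒≈ᴰ0 (λ x∣ε → ε*⇒≈ᴰ0 (cancel y x∣ε (≈ᴰ0⇒ε* xy≈0))) (dichotomy x)

-- Cyclic rotation of positions and the algebra of cyclic convolution.

module _ {m : ℕ} where

  -- The map `n ↦ n - 1` modulo `m + 1`: the coefficient of a product by the generator at `n` is the
  -- old coefficient at `n - 1`.
  rotate : Fin (suc m) → Fin (suc m)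
  rotate zero    = fromℕ m
  rotate (suc i) = inject₁ i

  rotate^ : ℕ → Fin (suc m) → Fin (suc m)
  rotate^ zero    n = n
  rotate^ (suc j) n = rotate^ j (rotate n)

  rotate^-+ : ∀ i j n → rotate^ (i ℕ.+ j) n ≡ rotate^ j (rotate^ i n)
  rotate^-+ zero    j n = ≡.refl
  rotate^-+ (suc i) j n = rotate^-+ i j (rotate n)

  rotate^-comm : ∀ i j n → rotate^ i (rotate^ j n) ≡ rotate^ j (rotate^ i n)
  rotate^-comm i j n = ≡.trans (≡.sym (rotate^-+ j i n)) (≡.trans (cong (λ l → rotate^ l n) (ℕ.+-comm j i)) (rotate^-+ i j n))

  toℕ-rotate^ : ∀ j n → j ≤ toℕ n → toℕ (rotate^ j n) ≡ toℕ n ∸ j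
  toℕ-rotate^ zero    n       j≤n       = ≡.refl
  toℕ-rotate^ (suc j) (suc n) (s≤s j≤n) = ≡.trans
    (toℕ-rotate^ j (inject₁ n) (subst (j ≤_) (≡.sym (toℕ-inject₁ n)) j≤n))
    (cong (_∸ j) (toℕ-inject₁ n))

  rotate^-toℕ : ∀ n → rotate^ (toℕ n) n ≡ zero
  rotate^-toℕ n = toℕ-injective (≡.trans (toℕ-rotate^ (toℕ n) n ℕ.≤-refl) (ℕ.n∸n≡0 (toℕ n)))

  -- After `toℕ n` steps position `0` is reached, one more step leads to `m`, and the remaining `l`
  -- steps descend from there.
  toℕ-rotate^-wrap : ∀ l n → l ≤ m → toℕ (rotate^ (toℕ n ℕ.+ suc l) n) ≡ m ∸ l
  toℕ-rotate^-wrap l n l≤m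
    rewrite rotate^-+ (toℕ n) (suc l) n | rotate^-toℕ n =
    ≡.trans (toℕ-rotate^ l (fromℕ m) (subst (l ≤_) (≡.sym (toℕ-fromℕ m)) l≤m)) (cong (_∸ l) (toℕ-fromℕ m))

  rotate^-period : ∀ n → rotate^ (suc m) n ≡ n
  rotate^-period n = toℕ-injective (begin
    toℕ (rotate^ (suc m) n)                             ≡⟨ cong (λ l → toℕ (rotate^ l n)) 1+m≡ ⟨
    toℕ (rotate^ (toℕ n ℕ.+ suc (m ∸ toℕ n)) n)         ≡⟨ toℕ-rotate^-wrap (m ∸ toℕ n) n (ℕ.m∸n≤m m (toℕ n)) ⟩
    m ∸ (m ∸ toℕ n)                                     ≡⟨ ℕ.m∸[m∸n]≡n n≤m ⟩
    toℕ n                                               ∎)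
    where
    open ≡.≡-Reasoning
    n≤m : toℕ n ≤ m
    n≤m = ℕ.≤-pred (toℕ<n n)
    1+m≡ : toℕ n ℕ.+ suc (m ∸ toℕ n) ≡ suc m
    1+m≡ = ≡.trans (ℕ.+-suc (toℕ n) (m ∸ toℕ n)) (cong suc (ℕ.m+[n∸m]≡n n≤m))

  -- Fewer than `toℕ n` steps stay above `0`; more steps, but at most `m`, have wrapped around to
  -- `m` and cannot have come down to `0` again. So only one term survives in a convolution with
  -- `one`.
  rotate^≢zero : ∀ i n → toℕ i ≢ toℕ n → rotate^ (toℕ i) n ≢ zero
  rotate^≢zero i n i≢n eq with ℕ.<-cmp (toℕ i) (toℕ n)
  ... | tri< i<n _ _ = ℕ.m>n⇒m∸n≢0 i<n (≡.trans (≡.sym (toℕ-rotate^ (toℕ i) n (ℕ.<⇒≤ i<n))) (cong toℕ eq))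
  ... | tri≈ _ i≡n _ = i≢n i≡n
  ... | tri> _ _ n<i with ℕ.m≤n⇒∃[o]m+o≡n n<i
  ...   | l , eq′ = ℕ.m>n⇒m∸n≢0 l<m (≡.trans (≡.sym toℕ-image) (cong toℕ eq))
    where
    l<m : l < m
    l<m = ℕ.≤-trans (ℕ.≤-trans (s≤s (ℕ.m≤n+m l (toℕ n))) (ℕ.≤-reflexive eq′)) (ℕ.≤-pred (toℕ<n i))
    toℕ-image : toℕ (rotate^ (toℕ i) n) ≡ m ∸ l
    toℕ-image = ≡.trans (cong (λ z → toℕ (rotate^ z n)) (≡.trans (≡.sym eq′) (≡.sym (ℕ.+-suc (toℕ n) l))))
      (toℕ-rotate^-wrap l n (ℕ.<⇒≤ l<m))

-- The algebra F[x]/(xᴺ - 1), N = 1 + m; multiplication by x is composition with rotate.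
module CyclicAlgebra {c ℓ} (F : CommutativeRing c ℓ) (m : ℕ) where

  private
    module F = CommutativeRing F
    open CommutativeRing F using (_≈_; _+_; _*_; -_; _-_; 0#; 1#)
    open import Algebra.Properties.Semiring.Sum F.semiring
    open import Relation.Binary.Reasoning.Setoid F.setoid

  N = suc m

  A : Set c
  A = Fin N → F.Carrier

  _≋_ : A → A → Set ℓ
  f ≋ g = ∀ i → f i ≈ g i

  one : A
  one zero    = 1#
  one (suc _) = 0#

  -- Cyclic convolution, as `rotate^ (toℕ i) n` is `n - i` modulo `N`.
  _⊛_ : A → A → A
  (f ⊛ g) n = ∑[ i < N ] (f i * g (rotate^ (toℕ i) n))

  ⊛-cong : ∀ {f f′ g g′} → f ≋ f′ → g ≋ g′ → (f ⊛ g) ≋ (f′ ⊛ g′)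
  ⊛-cong f≋ g≋ n = sum-cong-≋ {N} (λ i → F.*-cong (f≋ i) (g≋ (rotate^ (toℕ i) n)))

  sum-select : ∀ {n} (j : Fin n) (t : Fin n → F.Carrier) → (∀ i → toℕ i ≢ toℕ j → t i ≈ 0#) → sum t ≈ t j
  sum-select {suc n} zero t t≈0 =
    F.trans (F.+-congˡ (F.trans (sum-cong-≋ (λ i → t≈0 (suc i) (λ ()))) (sum-replicate-zero n))) (F.+-identityʳ _)
  sum-select {suc n} (suc j) t t≈0 =
    F.trans (F.+-cong (t≈0 zero (λ ())) (sum-select j (t ∘ suc) (λ i i≢j → t≈0 (suc i) (i≢j ∘ ℕ.suc-injective)))) (F.+-identityˡ _)

  one≢zero : ∀ {i} → i ≢ zero → one i ≈ 0#
  one≢zero {zero}  i≢0 = ⊥-elim (i≢0 ≡.refl)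
  one≢zero {suc i} _   = F.refl

  ⊛-identityʳ : ∀ f → (f ⊛ one) ≋ f
  ⊛-identityʳ f n = F.trans
    (sum-select n (λ i → f i * one (rotate^ (toℕ i) n)) (λ i i≢n → F.trans (F.*-congˡ (one≢zero (rotate^≢zero i n i≢n))) (F.zeroʳ (f i))))
    (F.trans (F.*-congˡ (F.reflexive (cong one (rotate^-toℕ n)))) (F.*-identityʳ _))

  -- Exchange the two sums and use that rotations commute. Taking `h` to be `one` gives
  -- commutativity, and then associativity follows, without any reindexing of a sum.
  ⊛-leftComm : ∀ f g h → (f ⊛ (g ⊛ h)) ≋ (g ⊛ (f ⊛ h))
  ⊛-leftComm f g h n = begin
    ∑[ i < N ] (f i * ∑[ j < N ] (g j * h (rotate^ (toℕ j) (rotate^ (toℕ i) n))))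
      ≈⟨ sum-cong-≋ (λ i → *-distribˡ-sum (f i) (λ j → g j * h (rotate^ (toℕ j) (rotate^ (toℕ i) n)))) ⟩
    ∑[ i < N ] ∑[ j < N ] (f i * (g j * h (rotate^ (toℕ j) (rotate^ (toℕ i) n))))
      ≈⟨ ∑-comm (λ i j → f i * (g j * h (rotate^ (toℕ j) (rotate^ (toℕ i) n)))) ⟩
    ∑[ j < N ] ∑[ i < N ] (f i * (g j * h (rotate^ (toℕ j) (rotate^ (toℕ i) n))))
      ≈⟨ sum-cong-≋ (λ j → sum-cong-≋ (λ i → swap (f i) (g j) (rotate^-comm (toℕ j) (toℕ i) n))) ⟩
    ∑[ j < N ] ∑[ i < N ] (g j * (f i * h (rotate^ (toℕ i) (rotate^ (toℕ j) n))))
      ≈⟨ sum-cong-≋ (λ j → *-distribˡ-sum (g j) (λ i → f i * h (rotate^ (toℕ i) (rotate^ (toℕ j) n)))) ⟨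
    ∑[ j < N ] (g j * ∑[ i < N ] (f i * h (rotate^ (toℕ i) (rotate^ (toℕ j) n)))) ∎
    where
    swap : ∀ a b {u v} → u ≡ v → a * (b * h u) ≈ b * (a * h v)
    swap a b {u} ≡.refl = F.trans (F.sym (F.*-assoc a b (h u))) (F.trans (F.*-congʳ (F.*-comm a b)) (F.*-assoc b a (h u)))

  ⊛-comm : ∀ f g → (f ⊛ g) ≋ (g ⊛ f)
  ⊛-comm f g n = begin
    (f ⊛ g) n           ≈⟨ ⊛-cong {f} (λ _ → F.refl) (λ i → F.sym (⊛-identityʳ g i)) n ⟩
    (f ⊛ (g ⊛ one)) n   ≈⟨ ⊛-leftComm f g one n ⟩
    (g ⊛ (f ⊛ one)) n   ≈⟨ ⊛-cong {g} (λ _ → F.refl) (⊛-identityʳ f) n ⟩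
    (g ⊛ f) n           ∎

  ⊛-assoc : ∀ f g h → ((f ⊛ g) ⊛ h) ≋ (f ⊛ (g ⊛ h))
  ⊛-assoc f g h n = begin
    ((f ⊛ g) ⊛ h) n     ≈⟨ ⊛-comm (f ⊛ g) h n ⟩
    (h ⊛ (f ⊛ g)) n     ≈⟨ ⊛-leftComm h f g n ⟩
    (f ⊛ (h ⊛ g)) n     ≈⟨ ⊛-cong {f} (λ _ → F.refl) (⊛-comm h g) n ⟩
    (f ⊛ (g ⊛ h)) n     ∎

  ⊛-distribˡ : ∀ f g h → (f ⊛ (λ i → g i + h i)) ≋ (λ i → (f ⊛ g) i + (f ⊛ h) i)
  ⊛-distribˡ f g h n = F.trans (sum-cong-≋ (λ i → F.distribˡ (f i) (g (r i)) (h (r i)))) (∑-distrib-+ (λ i → f i * g (r i)) (λ i → f i * h (r i)))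
    where r = λ (i : Fin N) → rotate^ (toℕ i) n

  algebra : CommutativeRing c ℓ
  algebra = record
    { Carrier = A
    ; _≈_ = _≋_
    ; _+_ = λ f g i → f i + g i
    ; _*_ = _⊛_
    ; -_  = λ f i → - f i
    ; 0#  = λ i → 0#
    ; 1#  = one
    ; isCommutativeRing = record
      { isRing = record
        { +-isAbelianGroup = record
          { isGroup = record
            { isMonoid = record
              { isSemigroup = record
                { isMagma = record
                  { isEquivalence = record
                    { refl  = λ _ → F.refl
                    ; sym   = λ e i → F.sym (e i)
                    ; trans = λ e e′ i → F.trans (e i) (e′ i)
                    }
                  ; ∙-cong = λ e e′ i → F.+-cong (e i) (e′ i)
                  }
                ; assoc = λ f g h i → F.+-assoc _ _ _
                }
              ; identity = (λ f i → F.+-identityˡ _) , (λ f i → F.+-identityʳ _)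
              }
            ; inverse = (λ f i → F.-‿inverseˡ _) , (λ f i → F.-‿inverseʳ _)
            ; ⁻¹-cong = λ e i → F.-‿cong (e i)
            }
          ; comm = λ f g i → F.+-comm _ _
          }
        ; *-cong = ⊛-cong
        ; *-assoc = ⊛-assoc
        ; *-identity = (λ f n → F.trans (⊛-comm one f n) (⊛-identityʳ f n)) , ⊛-identityʳ
        ; distrib = ⊛-distribˡ , (λ f g h n → F.trans (⊛-comm (λ i → g i + h i) f n)
            (F.trans (⊛-distribˡ f g h n) (F.+-cong (⊛-comm f g n) (⊛-comm f h n))))
        }
      ; *-comm = ⊛-comm
      }
    }

  private
    module R = CommutativeRing algebra
    module E where
      open import Algebra.Properties.CommutativeSemiring.Exp R.commutativeSemiring public
    open E using (_^_)

  gen : A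
  gen n = one (rotate n)

  -- Because rotations commute, `f ⊛ gen` at `n` is `f ⊛ one` at `rotate n`.
  gen*f : ∀ f → (gen ⊛ f) ≋ (f ∘ rotate)
  gen*f f n = F.trans (⊛-comm gen f n) (F.trans
    (sum-cong-≋ {N} (λ i → F.*-congˡ {f i} (F.reflexive (cong one (rotate^-comm 1 (toℕ i) n)))))
    (⊛-identityʳ f (rotate n)))

  gen^*f : ∀ j f → ((gen ^ j) ⊛ f) ≋ (f ∘ rotate^ j)
  gen^*f zero    f = R.*-identityˡ f
  gen^*f (suc j) f n = F.trans (⊛-assoc gen (gen ^ j) f n) (F.trans (gen*f ((gen ^ j) ⊛ f) n) (gen^*f j f (rotate n)))

  gen^≋ : ∀ j → (gen ^ j) ≋ (one ∘ rotate^ j)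
  gen^≋ j n = F.trans (F.sym (⊛-identityʳ (gen ^ j) n)) (gen^*f j one n)

  gen^N≋one : (gen ^ N) ≋ one
  gen^N≋one n = F.trans (gen^≋ N n) (F.reflexive (cong one (rotate^-period n)))

  -- Conditions only on positions that exist, hence vacuous for `D ≥ N`. Degrees can therefore be
  -- added freely, and `D < N` is checked once, in `monic≉0`.
  Monic : ℕ → A → Set ℓ
  Monic D f = ∀ i → (toℕ i ≡ D → f i ≈ 1#) × (D < toℕ i → f i ≈ 0#)

  one-monic : Monic 0 one
  one-monic zero    = (λ _ → F.refl) , λ ()
  one-monic (suc i) = (λ ()) , (λ _ → F.refl)

  -- The coefficient that wraps around lands at position `0`, where being monic of degree `suc D`
  -- demands nothing.
  rotate-monic : ∀ {D f} → Monic D f → Monic (suc D) (f ∘ rotate)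
  rotate-monic f-monic zero    = (λ ()) , λ ()
  rotate-monic f-monic (suc i) =
    (λ eq → proj₁ (f-monic (inject₁ i)) (≡.trans (toℕ-inject₁ i) (ℕ.suc-injective eq))) ,
    (λ { (s≤s lt) → proj₂ (f-monic (inject₁ i)) (subst (_ <_) (≡.sym (toℕ-inject₁ i)) lt) })

  rotate^-monic : ∀ n {D f} → Monic D f → Monic (n ℕ.+ D) (f ∘ rotate^ n)
  rotate^-monic zero    f-monic = f-monic
  rotate^-monic (suc n) f-monic = rotate-monic (rotate^-monic n f-monic)

  -- The product is the shift of `f` by `n` minus `f`, and for `n > 0` the subtracted `f` has no
  -- coefficient in degree `n + D` or above.
  [gen^n-1]*-monic : ∀ n {D f} → 0 < n → Monic D f → Monic (n ℕ.+ D) (((gen ^ n) R.- one) R.* f)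
  [gen^n-1]*-monic n {D} {f} 0<n f-monic i =
    (λ eq → F.trans (expand i) (F.trans
      (F.+-cong (proj₁ (rotate^-monic n f-monic i) eq) (minus (ℕ.<-≤-trans D<n+D (ℕ.≤-reflexive (≡.sym eq)))))
      (F.+-identityʳ 1#))) ,
    (λ lt → F.trans (expand i) (F.trans (F.+-cong (proj₂ (rotate^-monic n f-monic i) lt) (minus (ℕ.<-trans D<n+D lt))) (F.+-identityʳ 0#)))
    where
    open import Algebra.Properties.Ring F.ring using (-0#≈0#)
    open import Algebra.Properties.Ring R.ring using ([y-z]x≈yx-zx)
    D<n+D : D < n ℕ.+ D
    D<n+D = ℕ.+-monoˡ-≤ D 0<n
    expand : (((gen ^ n) R.- one) R.* f) ≋ (λ i → f (rotate^ n i) - f i)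
    expand i = F.trans ([y-z]x≈yx-zx f (gen ^ n) one i) (F.+-cong (gen^*f n f i) (F.-‿cong (R.*-identityˡ f i)))
    minus : D < toℕ i → - f i ≈ 0#
    minus lt = F.trans (F.-‿cong (proj₂ (f-monic i) lt)) -0#≈0#

  monic≉0 : 1# F.≉ 0# → ∀ {D f} → D < N → Monic D f → f R.≉ R.0#
  monic≉0 1≉0 {D} {f} D<N f-monic f≈0 = 1≉0 (F.trans (F.sym (proj₁ (f-monic (fromℕ< D<N)) (toℕ-fromℕ< D<N))) (f≈0 (fromℕ< D<N)))

-- The integers modulo `p`.

module IntegersMod (p : ℕ) where

  open Quotient ℤ.+-*-commutativeRing (+ p ℤ∣.∣_)

  ℤ/p : CommutativeRing 0ℓ 0ℓ
  ℤ/p = quotientRing (λ { ≡.refl d → d }) (ℤ∣.divides 0ℤ ≡.refl) ℤ∣.∣m∣n⇒∣m+n (λ a → ℤ∣.∣n⇒∣m*n a)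

  open CommutativeRing ℤ/p using (_≈_; _≉_; _-_; 0#; 1#; semiring)
  open import Algebra.Properties.Semiring.Mult semiring using () renaming (_×_ to _·_)

  n·1≡n : ∀ n → n · 1# ≡ + n
  n·1≡n zero    = ≡.refl
  n·1≡n (suc n) = cong ℤ.suc (n·1≡n n)

  characteristic : p · 1# ≈ 0#
  characteristic rewrite n·1≡n p = ℤ∣.divides 1ℤ (≡.trans (ℤ.+-identityʳ (+ p)) (≡.sym (ℤ.*-identityˡ (+ p))))

  _≈?_ : Decidable _≈_
  a ≈? b = + p ℤ∣.∣? (a - b)

  1≉0 : 1 < p → 1# ≉ 0#
  1≉0 1<p d = ℕ.<⇒≱ 1<p (ℕ.∣⇒≤ (ℤ∣.∣⇒∣ᵤ d))

  residue : .{{_ : ℕ.NonZero p}} → ∀ a → ∃ λ (i : Fin p) → a ≈ toℕ i · 1#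
  residue a = fromℕ< (n%ℕd<d a p) , subst (a ≈_) (≡.sym (≡.trans (n·1≡n _) (cong +_ (toℕ-fromℕ< (n%ℕd<d a p)))))
    (ℤ∣.divides (a /ℕ p) (≡.trans (cong (ℤ._- + (a %ℕ p)) (a≡a%ℕn+[a/ℕn]*n a p)) (cancel (+ (a %ℕ p)) (a /ℕ p ℤ.* + p))))
    where
    open IntegerSolver ℤ.+-*-commutativeRing
    cancel : ∀ r s → (r ℤ.+ s) ℤ.- r ≡ s
    cancel = solve 2 (λ r s → (r :+ s) :- r := s) ≡.refl

-- The separator of the conjugates and the field of order `p ^ k`.

module Separator {c ℓ} (R : CommutativeRing c ℓ) (x : CommutativeRing.Carrier R) (p : ℕ) where

  open CommutativeRing R
  open import Algebra.Properties.CommutativeSemiring.Exp commutativeSemiring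
  open import Algebra.Properties.Semiring.Divisibility semiring using (_∣_; _,_; ∣-trans)

  -- For prime `p`, `x * factor d` is `x ^ (p ^ d) - x`; thus in a domain where `x` and `factor d`
  -- are nonzero, the `d`-th conjugate of `x` differs from `x`.
  factor : ℕ → Carrier
  factor d = x ^ ℕ.pred (p ℕ.^ d) - 1#

  separator : ℕ → Carrier
  separator zero    = 1#
  separator (suc j) = factor (suc j) * separator j

  factor∣separator : ∀ {d} j → 0 < d → d ≤ j → factor d ∣ separator j
  factor∣separator {d} zero 0<d d≤0 = ⊥-elim (ℕ.<⇒≱ 0<d d≤0)
  factor∣separator {d} (suc j) 0<d d≤1+j with ℕ.m≤n⇒m<n∨m≡n d≤1+j
  ... | inj₂ ≡.refl    = separator j , *-comm (separator j) _
  ... | inj₁ (s≤s d≤j) = ∣-trans (factor∣separator j 0<d d≤j) (_ , refl)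

module _ (p : ℕ) (prime : Prime p) where

  private
    instance
      p≢0 : ℕ.NonZero p
      p≢0 = ℕ.>-nonZero (ℕ.<-trans (s≤s z≤n) (prime>1 prime))

  module SeparableRing {c ℓ} (R : CommutativeRing c ℓ) where

    open CommutativeRing R
    open import Algebra.Properties.CommutativeSemiring.Exp commutativeSemiring
    open import Algebra.Properties.Semiring.Mult semiring using () renaming (_×_ to _·_)
    open import Algebra.Properties.Semiring.Divisibility semiring using (_∣_; _,_; ∣-trans)
    open import Algebra.Properties.Ring ring using (x[y-z]≈xy-xz)
    open ReducedQuotient R

    module _ (k m : ℕ) (0<k : 0 < k) (p^k≡2+m : p ℕ.^ k ≡ 2 ℕ.+ m)
             (_≈?_ : Decidable _≈_) (char : p · 1# ≈ 0#) (y^q≈y : ∀ y → y ^ (p ℕ.^ k) ≈ y)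
             (x : Carrier) (x^[1+m]≈1 : x ^ suc m ≈ 1#)
             where

      open Separator R x p

      private
        q = p ℕ.^ k

        y^[2+m]≈y : ∀ y → y ^ (2 ℕ.+ m) ≈ y
        y^[2+m]≈y y = trans (reflexive (cong (y ^_) (≡.sym p^k≡2+m))) (y^q≈y y)

        k≡1+ : k ≡ suc (ℕ.pred k)
        k≡1+ = ≡.sym (ℕ.suc-pred k {{ℕ.>-nonZero 0<k}})

        e : Carrier
        e = separator (ℕ.pred k)

        module Residue (ε : Carrier) (ε≉0 : ε ≉ 0#) (e∣ε : e ∣ ε) (dichotomy : ∀ y → ε * y ≈ 0# ⊎ y ∣ ε) where

          K : CommutativeRing c ℓ
          K = domain _≈?_ ε ε≉0 dichotomy m y^[2+m]≈y

          module K where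
            open CommutativeRing K public
            open import Algebra.Properties.Semiring.Mult (CommutativeRing.semiring K) public using () renaming (_×_ to _·_)
            open import Algebra.Properties.Semiring.Exp (CommutativeRing.semiring K) public using (_^_)

          -- `K` has the operations of `R`, but multiples and powers are recursions over two
          -- different bundles, and their agreement needs induction.
          K-· : ∀ n y → n K.· y ≡ n · y
          K-· zero    y = ≡.refl
          K-· (suc n) y = cong (λ z → y + z) (K-· n y)

          K-^ : ∀ n y → y K.^ n ≡ y ^ n
          K-^ zero    y = ≡.refl
          K-^ (suc n) y = cong (λ z → y * z) (K-^ n y)

          fromR : ∀ {y z} → y ≈ z → y K.≈ z
          fromR {y} {z} = ≈⇒≈ᴰ _≈?_ ε ε≉0 dichotomy m y^[2+m]≈y {y} {z}

          K-integral : ∀ y z → y K.* z K.≈ K.0# → y K.≈ K.0# ⊎ z K.≈ K.0#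
          K-integral = domain-integral _≈?_ ε ε≉0 dichotomy m y^[2+m]≈y

          nonzero : ∀ {y} → y ∣ e → y K.≉ K.0#
          nonzero {y} y∣e = divisor≉0 _≈?_ ε ε≉0 dichotomy m y^[2+m]≈y {y} (∣-trans y∣e e∣ε)

          1≉0 : K.1# K.≉ K.0#
          1≉0 = nonzero {1#} (e , *-identityʳ e)

          x≉0 : x K.≉ K.0#
          x≉0 x≈0 = 1≉0 (K.trans {1#} {x ^ suc m} {0#} (fromR {1#} {x ^ suc m} (sym x^[1+m]≈1))
            (K.trans {x ^ suc m} {0# * x ^ m} {0#} (K.*-congʳ {x ^ m} {x} {0#} x≈0) (K.zeroˡ (x ^ m))))

          -- Otherwise `x * factor d` would vanish in `K`. But `x` is a root of unity, and
          -- `factor d` divides the separator, hence `ε`, so neither factor is zero.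
          x-generic : ∀ d → 0 < d → d < k → (x ^ (p ℕ.^ d)) K.≉ x
          x-generic d 0<d d<k eq with K-integral x (factor d) product≈0
            where
            expand : x * factor d ≈ x ^ (p ℕ.^ d) - x
            expand = trans (x[y-z]≈xy-xz x (x ^ ℕ.pred (p ℕ.^ d)) 1#)
              (+-cong (reflexive (cong (x ^_) (ℕ.suc-pred (p ℕ.^ d) {{ℕ.m^n≢0 p d}}))) (-‿cong (*-identityʳ x)))
            product≈0 : x * factor d K.≈ 0#
            product≈0 = K.trans {x * factor d} {x ^ (p ℕ.^ d) - x} {0#} (fromR {x * factor d} {x ^ (p ℕ.^ d) - x} expand)
              (K.trans {x ^ (p ℕ.^ d) - x} {x - x} {0#} (K.+-congʳ { - x} {x ^ (p ℕ.^ d)} {x} eq) (K.-‿inverseʳ x))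
          ... | inj₁ x≈0      = x≉0 x≈0
          ... | inj₂ factor≈0 = nonzero {factor d} (factor∣separator (ℕ.pred k) 0<d (ℕ.≤-pred (ℕ.≤-trans d<k (ℕ.≤-reflexive k≡1+)))) factor≈0

          result : IntegralDomainOn (Fin q)
          result = Domain.integralDomainOnFin K K-integral 1≉0 p prime
            (subst (K._≈ 0#) (≡.sym (K-· p 1#)) (fromR {p · 1#} {0#} char)) k 0<k x
            (λ d 0<d d<k eq → x-generic d 0<d d<k (subst (K._≈ x) (K-^ (p ℕ.^ d) x) eq))
            (λ y → subst (K._≈ y) (≡.sym (K-^ q y)) (fromR {y ^ q} {y} (y^q≈y y)))
            (domain-≈? _≈?_ ε ε≉0 dichotomy m y^[2+m]≈y)

      residueField : ∀ ys → (∀ y → Any (y ≈_) ys) → separator (ℕ.pred k) ≉ 0# → IntegralDomainOn (Fin q)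
      residueField ys complete e≉0 with maximalMultiple _≈?_ ys complete e e≉0
      ... | ε , ε≉0 , e∣ε , dichotomy = Residue.result ε ε≉0 e∣ε dichotomy

  module CyclicAlgebraModP {c ℓ} (F : CommutativeRing c ℓ) where

    private
      module F where
        open CommutativeRing F public
        open import Algebra.Properties.Semiring.Mult semiring public renaming (_×_ to _·_)
        open import Algebra.Properties.Semiring.Sum semiring public
        open Frobenius F p prime public

    module _ (char : p F.· F.1# F.≈ F.0#) (F-≈? : Decidable F._≈_) (1≉0 : F.1# F.≉ F.0#)
             (residue : ∀ a → ∃ λ (i : Fin p) → a F.≈ toℕ i F.· F.1#)
             (k m : ℕ) (0<k : 0 < k) (p^k≡2+m : p ℕ.^ k ≡ 2 ℕ.+ m)
             where

      open CyclicAlgebra F m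

      private
        q = p ℕ.^ k
        module R = CommutativeRing algebra
        open import Algebra.Properties.CommutativeSemiring.Exp R.commutativeSemiring
        open import Algebra.Properties.Semiring.Mult R.semiring using () renaming (_×_ to _·_)
        open import Algebra.Properties.Semiring.Sum R.semiring using (sum)
        open Frobenius algebra p prime using (^pⁿ-distrib-+)
        open Separator algebra gen p using (separator)

        ·-pointwise : ∀ n f i → (n · f) i ≡ n F.· f i
        ·-pointwise zero    f i = ≡.refl
        ·-pointwise (suc n) f i = cong (f i F.+_) (·-pointwise n f i)

        sum-pointwise : ∀ {l} (t : Fin l → A) i → sum t i ≡ F.sum (λ j → t j i)
        sum-pointwise {zero}  t i = ≡.refl
        sum-pointwise {suc l} t i = cong (t zero i F.+_) (sum-pointwise (t ∘ suc) i)

        algebra-char : p · R.1# R.≈ R.0#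
        algebra-char i = F.trans (F.reflexive (·-pointwise p R.1# i)) (F.p∣n⇒n×x≈0 char ℕ.∣-refl (R.1# i))

        Fixed : A → Set ℓ
        Fixed f = f ^ q R.≈ f

        Fixed-resp : ∀ {f g} → f R.≈ g → Fixed f → Fixed g
        Fixed-resp f≈g fixed = R.trans (^-congˡ q (R.sym f≈g)) (R.trans fixed f≈g)

        Fixed-0 : Fixed R.0#
        Fixed-0 rewrite p^k≡2+m = R.zeroˡ _

        Fixed-+ : ∀ {f g} → Fixed f → Fixed g → Fixed (f R.+ g)
        Fixed-+ {f} {g} a b = R.trans (^pⁿ-distrib-+ algebra-char k f g) (R.+-cong a b)

        Fixed-· : ∀ n {f} → Fixed f → Fixed (n · f)
        Fixed-· zero    fixed = Fixed-0
        Fixed-· (suc n) fixed = Fixed-+ fixed (Fixed-· n fixed)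

        Fixed-sum : ∀ {l} (t : Fin l → A) → (∀ i → Fixed (t i)) → Fixed (sum t)
        Fixed-sum {zero}  t fixed = Fixed-0
        Fixed-sum {suc l} t fixed = Fixed-+ (fixed zero) (Fixed-sum (t ∘ suc) (fixed ∘ suc))

        Fixed-gen^ : ∀ i → Fixed (gen ^ i)
        Fixed-gen^ i = begin
          (gen ^ i) ^ q       ≈⟨ ^-assocʳ gen i q ⟩
          gen ^ (i ℕ.* q)     ≡⟨ cong (gen ^_) (ℕ.*-comm i q) ⟩
          gen ^ (q ℕ.* i)     ≈⟨ ^-assocʳ gen q i ⟨
          (gen ^ q) ^ i       ≡⟨ cong (λ n → (gen ^ n) ^ i) p^k≡2+m ⟩
          (gen R.* gen ^ N) ^ i ≈⟨ ^-congˡ i (R.trans (R.*-congˡ {gen} gen^N≋one) (R.*-identityʳ gen)) ⟩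
          gen ^ i             ∎
          where open import Relation.Binary.Reasoning.Setoid R.setoid

        -- Coefficients are replaced by natural representatives, so that scalar multiples become
        -- repeated sums, to which `Fixed-+` applies.
        expansion : ∀ f → f R.≈ sum (λ (i : Fin N) → toℕ (proj₁ (residue (f i))) · (gen ^ toℕ i))
        expansion f n = begin
          f n                                                       ≈⟨ ⊛-identityʳ f n ⟨
          F.sum {N} (λ i → f i F.* one (rotate^ (toℕ i) n))         ≈⟨ F.sum-cong-≋ {N} term ⟩
          F.sum {N} (λ i → (r i · (gen ^ toℕ i)) n)                 ≡⟨ sum-pointwise (λ i → r i · (gen ^ toℕ i)) n ⟨
          sum {N} (λ i → r i · (gen ^ toℕ i)) n                     ∎
          where
          open import Relation.Binary.Reasoning.Setoid F.setoid
          r : Fin N → ℕ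
          r i = toℕ (proj₁ (residue (f i)))
          term : ∀ i → f i F.* one (rotate^ (toℕ i) n) F.≈ (r i · (gen ^ toℕ i)) n
          term i = begin
            f i F.* one (rotate^ (toℕ i) n)        ≈⟨ F.*-cong {f i} {r i F.· F.1#} (proj₂ (residue (f i))) (F.sym (gen^≋ (toℕ i) n)) ⟩
            (r i F.· F.1#) F.* (gen ^ toℕ i) n     ≈⟨ F.×-assoc-* (r i) F.1# ((gen ^ toℕ i) n) ⟩
            r i F.· (F.1# F.* (gen ^ toℕ i) n)     ≈⟨ F.×-congʳ (r i) (F.*-identityˡ ((gen ^ toℕ i) n)) ⟩
            r i F.· (gen ^ toℕ i) n                ≡⟨ ·-pointwise (r i) (gen ^ toℕ i) n ⟨
            (r i · (gen ^ toℕ i)) n                ∎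

        -- The `q`-th power is additive, and it fixes every power of `gen` because `gen ^ N` is
        -- `one` and `q = N + 1`.
        f^q≈f : ∀ f → Fixed f
        f^q≈f f = Fixed-resp (R.sym (expansion f)) (Fixed-sum {N} _ (λ i → Fixed-· (toℕ (proj₁ (residue (f i)))) (Fixed-gen^ (toℕ i))))

        algebra-≈? : Decidable R._≈_
        algebra-≈? f g = all? (λ i → F-≈? (f i) (g i))

        elements : List A
        elements = tabulate {n = p ℕ.^ N} (λ l i → toℕ (finToFun {p} {N} l i) F.· F.1#)

        elements-complete : ∀ f → Any (f R.≈_) elements
        elements-complete f = Any.tabulate⁺ (funToFin digits) (λ i →
          subst (λ d → f i F.≈ toℕ d F.· F.1#) (≡.sym (finToFun-funToFin digits i)) (proj₂ (residue (f i))))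
          where
          digits : Fin N → Fin p
          digits i = proj₁ (residue (f i))

        degree : ℕ → ℕ
        degree zero    = 0
        degree (suc j) = ℕ.pred (p ℕ.^ suc j) ℕ.+ degree j

        p^≥2 : ∀ j → 2 ≤ p ℕ.^ suc j
        p^≥2 j = ℕ.≤-trans (prime>1 prime) (ℕ.m≤m*n p (p ℕ.^ j) {{ℕ.m^n≢0 p j}})

        separator-monic : ∀ j → Monic (degree j) (separator j)
        separator-monic zero    = one-monic
        separator-monic (suc j) = [gen^n-1]*-monic (ℕ.pred (p ℕ.^ suc j)) (ℕ.pred-mono-≤ (p^≥2 j)) (separator-monic j)

        -- The degree is the sum of `p ^ d - 1` for `1 ≤ d ≤ j`, and `p ≥ 2` makes each power at
        -- least double the previous one. The summand `2` is what gives a degree below `N = q - 1`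
        -- at `j = k - 1`.
        degree-bound : ∀ j → degree j ℕ.+ 2 ≤ p ℕ.^ suc j
        degree-bound zero    = p^≥2 zero
        degree-bound (suc j) = begin
          (ℕ.pred P ℕ.+ degree j) ℕ.+ 2     ≡⟨ ℕ.+-assoc (ℕ.pred P) (degree j) 2 ⟩
          ℕ.pred P ℕ.+ (degree j ℕ.+ 2)     ≤⟨ ℕ.+-mono-≤ (ℕ.pred[n]≤n {P}) (degree-bound j) ⟩
          P ℕ.+ P                           ≡⟨ cong (P ℕ.+_) (ℕ.+-identityʳ P) ⟨
          2 ℕ.* P                           ≤⟨ ℕ.*-monoˡ-≤ P (prime>1 prime) ⟩
          p ℕ.* P                           ∎
          where
          open ℕ.≤-Reasoning
          P = p ℕ.^ suc j

        k≡1+ : k ≡ suc (ℕ.pred k)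
        k≡1+ = ≡.sym (ℕ.suc-pred k {{ℕ.>-nonZero 0<k}})

        degree<N : degree (ℕ.pred k) < N
        degree<N = ℕ.≤-pred (ℕ.≤-trans (ℕ.≤-reflexive (ℕ.+-comm 2 (degree (ℕ.pred k))))
          (ℕ.≤-trans (degree-bound (ℕ.pred k)) (ℕ.≤-reflexive (≡.trans (cong (p ℕ.^_) (≡.sym k≡1+)) p^k≡2+m))))

      field-of-order : IntegralDomainOn (Fin q)
      field-of-order = SeparableRing.residueField algebra k m 0<k p^k≡2+m algebra-≈? algebra-char f^q≈f gen gen^N≋one
        elements elements-complete (monic≉0 1≉0 degree<N (separator-monic (ℕ.pred k)))

  galoisField : ∀ k m → 0 < k → p ℕ.^ k ≡ 2 ℕ.+ m → IntegralDomainOn (Fin (p ℕ.^ k))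
  galoisField = CyclicAlgebraModP.field-of-order ℤ/p characteristic _≈?_ (1≉0 (prime>1 prime)) residue
    where open IntegersMod p

-- Finite bijections and counting by enumeration.

open ≡ using (refl; sym; trans)

injective⇒surjective : ∀ {n} {f : Fin n → Fin n} → Injective _≡_ _≡_ f → ∀ y → ∃ λ x → f x ≡ y
injective⇒surjective {suc n} {f} inj y with any? (λ x → f x Fin.≟ y)
... | yes hit = hit
... | no miss = ⊥-elim (ℕ.1+n≰n (injective⇒≤ {f = λ x → punchOut (y≢f x)}
                  (λ {x} {x′} eq → inj (punchOut-injective (y≢f x) (y≢f x′) eq))))
  where
  y≢f : ∀ x → y ≢ f x
  y≢f x y≡fx = miss (x , sym y≡fx)

injective⇒permutation : ∀ {n} (f : Fin n → Fin n) → Injective _≡_ _≡_ f → Permutation′ n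
injective⇒permutation f inj = mk↔ₛ′ f (proj₁ ∘ surj) (proj₂ ∘ surj) (λ x → inj (proj₂ (surj (f x))))
  where surj = injective⇒surjective inj

module _ {A : Set} {n : ℕ} (A↔Fin : Fin n ↔ A) where

  open Inverse A↔Fin using (to; from; strictlyInverseˡ; strictlyInverseʳ)

  to-injective : Injective _≡_ _≡_ to
  to-injective {x} {y} eq = trans (sym (strictlyInverseʳ x)) (trans (cong from eq) (strictlyInverseʳ y))

  from-injective : Injective _≡_ _≡_ from
  from-injective {x} {y} eq = trans (sym (strictlyInverseˡ x)) (trans (cong to eq) (strictlyInverseˡ y))

  finite-injective⇒surjective : {f : A → A} → Injective _≡_ _≡_ f → ∀ y → ∃ λ x → f x ≡ y
  finite-injective⇒surjective {f} inj y
    with injective⇒surjective {f = from ∘ f ∘ to} (to-injective ∘ inj ∘ from-injective) (from y)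
  ... | i , eq = to i , from-injective eq

length-filter-map : ∀ {A B : Set} {P : Pred B 0ℓ} (P? : Decidable₁ P) (f : A → B) xs →
  length (filter P? (map f xs)) ≡ length (filter (P? ∘ f) xs)
length-filter-map P? f [] = refl
length-filter-map P? f (x ∷ xs) with P? (f x)
... | yes _ = cong suc (length-filter-map P? f xs)
... | no  _ = length-filter-map P? f xs

-- The map `g` enumerates the solutions without repetition, and two duplicate-free lists with the
-- same members are permutations of each other.
length-filter-allFin : ∀ {n r} {P : Pred (Fin n) 0ℓ} (P? : Decidable₁ P) (g : Fin r → Fin n) → Injective _≡_ _≡_ g →
  (∀ j → P (g j)) → (∀ i → P i → ∃ λ j → g j ≡ i) → length (filter P? (allFin n)) ≡ r
length-filter-allFin {n} P? g inj sound complete = trans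
  (↭-length (∼bag⇒↭ (unique∧set⇒bag (Unique.filter⁺ P? (Unique.allFin⁺ n)) (Unique.tabulate⁺ {f = g} inj) (mk⇔ forward backward))))
  (length-tabulate g)
  where
  forward : ∀ {i} → i ∈ filter P? (allFin n) → i ∈ tabulate g
  forward i∈ with complete _ (proj₂ (∈-filter⁻ P? {xs = allFin n} i∈))
  ... | j , refl = ∈-tabulate⁺ j
  backward : ∀ {i} → i ∈ tabulate g → i ∈ filter P? (allFin n)
  backward i∈ with ∈-tabulate⁻ i∈
  ... | j , refl = ∈-filter⁺ P? (∈-allFin (g j)) (sound j)

-- At most one entry is filtered out. This turns agreement in at most one point into a Hamming
-- distance of at least `n - 1`.
length-filter-¬ : ∀ {A : Set} {P : Pred A 0ℓ} (P? : Decidable₁ P) → (∀ {x y} → P x → P y → x ≡ y) →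
  ∀ {xs} → Unique xs → length xs ≤ suc (length (filter (λ x → ¬? (P? x)) xs))
length-filter-¬ P? unique [] = z≤n
length-filter-¬ P? unique {x ∷ xs} (x≢ ∷ u) with P? x
... | yes px = s≤s (ℕ.≤-reflexive (cong length (sym (filter-all (λ y → ¬? (P? y)) (All.map (λ x≢y py → x≢y (unique px py)) x≢)))))
... | no ¬px = s≤s (length-filter-¬ P? unique u)

AllPairs-lookup : ∀ {A : Set} {R : Rel A 0ℓ} → Symmetric R → ∀ {xs} → AllPairs R xs →
  ∀ i j → i ≢ j → R (lookup xs i) (lookup xs j)
AllPairs-lookup R-sym (r ∷ rs) zero    zero    i≢j = ⊥-elim (i≢j refl)
AllPairs-lookup R-sym (r ∷ rs) zero    (suc j) i≢j = All.lookup r (∈-lookup j)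
AllPairs-lookup R-sym (r ∷ rs) (suc i) zero    i≢j = R-sym (All.lookup r (∈-lookup i))
AllPairs-lookup R-sym (r ∷ rs) (suc i) (suc j) i≢j = AllPairs-lookup R-sym rs i j (i≢j ∘ cong suc)

-- From an abstract family of words to an idempotent permutation code.

module Code {Point Index : Set} {n M r : ℕ} (point : Fin n ↔ Point) (index : Fin M ↔ Index)
  (word : Index → Point → Point)
  (word-injective : ∀ w → Injective _≡_ _≡_ (word w))
  (agree-once : ∀ {v w} → v ≢ w → ∀ {x y} → word v x ≡ word w x → word v y ≡ word w y → x ≡ y)
  (fixed-point : ∀ w → ∃ λ x → word w x ≡ x × (∀ y → word w y ≡ y → x ≡ y))
  (fixer : Point → Fin r → Index)
  (fixer-injective : ∀ x → Injective _≡_ _≡_ (fixer x))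
  (fixer-fixes : ∀ x j → word (fixer x j) x ≡ x)
  (fixer-complete : ∀ x w → word w x ≡ x → ∃ λ j → fixer x j ≡ w)
  where

  private
    module P = Inverse point
    module I = Inverse index

    action : Fin M → Fin n → Fin n
    action w = P.from ∘ word (I.to w) ∘ P.to

    action-fixes⁻ : ∀ {w x} → action w x ≡ x → word (I.to w) (P.to x) ≡ P.to x
    action-fixes⁻ eq = trans (sym (P.strictlyInverseˡ _)) (cong P.to eq)

    action-fixes⁺ : ∀ {w x} → word (I.to w) (P.to x) ≡ P.to x → action w x ≡ x
    action-fixes⁺ {x = x} eq = trans (cong P.from eq) (P.strictlyInverseʳ x)

    perm : Fin M → Permutation′ n
    perm w = injective⇒permutation (action w) (to-injective point ∘ word-injective (I.to w) ∘ from-injective point)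

  code : List (Permutation′ n)
  code = tabulate perm

  private
    code-distance : IsPC n (n ∸ 1) code
    -- Taking predecessors in `n ≤ 1 + distance` gives the bound with `n ∸ 1`.
    code-distance i j i≢j = ℕ.pred-mono-≤ {n} (ℕ.≤-trans (ℕ.≤-reflexive (sym (length-tabulate {n = n} id)))
      (length-filter-¬ (λ x → (lookup code i ⟨$⟩ʳ x) Fin.≟ (lookup code j ⟨$⟩ʳ x)) agree (Unique.allFin⁺ n)))
      where
      AgreeOnce : Rel (Permutation′ n) 0ℓ
      AgreeOnce σ τ = ∀ x y → σ ⟨$⟩ʳ x ≡ τ ⟨$⟩ʳ x → σ ⟨$⟩ʳ y ≡ τ ⟨$⟩ʳ y → x ≡ y
      agree : ∀ {x y} → lookup code i ⟨$⟩ʳ x ≡ lookup code j ⟨$⟩ʳ x → lookup code i ⟨$⟩ʳ y ≡ lookup code j ⟨$⟩ʳ y → x ≡ y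
      agree = AllPairs-lookup {R = AgreeOnce} (λ once x y a b → once x y (sym a) (sym b))
        (AllPairs.tabulate⁺ (λ v≢w x y a b → to-injective point
          (agree-once (v≢w ∘ to-injective index) (from-injective point a) (from-injective point b)))) i j i≢j _ _

    code-idempotent : IsIdempotent code
    code-idempotent i = All.lookup (All.tabulate⁺ {P = λ σ → fixCount σ ≡ 1} {f = perm} one-fixed-point) (∈-lookup i)
      where
      one-fixed-point : ∀ w → fixCount (perm w) ≡ 1
      one-fixed-point w with fixed-point (I.to w)
      ... | x , fixes , only = length-filter-allFin (λ y → action w y Fin.≟ y) (λ (_ : Fin 1) → P.from x)
        (λ { {zero} {zero} _ → refl })
        (λ _ → action-fixes⁺ {w} (subst (λ z → word (I.to w) z ≡ z) (sym (P.strictlyInverseˡ x)) fixes))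
        (λ y eq → zero , trans (cong P.from (only (P.to y) (action-fixes⁻ {w} eq))) (P.strictlyInverseʳ y))

    code-fixers : ∀ x → fixersOf code x ≡ r
    code-fixers x = begin
      length (filter fixes? (tabulate perm))         ≡⟨ cong (length ∘ filter fixes?) (map-tabulate id perm) ⟨
      length (filter fixes? (map perm (allFin M)))   ≡⟨ length-filter-map fixes? perm (allFin M) ⟩
      length (filter (fixes? ∘ perm) (allFin M))     ≡⟨ length-filter-allFin (fixes? ∘ perm) (I.from ∘ fixer (P.to x))
        (fixer-injective (P.to x) ∘ from-injective index)
        (λ j → action-fixes⁺ {I.from (fixer (P.to x) j)} (subst (λ w → word w (P.to x) ≡ P.to x) (sym (I.strictlyInverseˡ _)) (fixer-fixes (P.to x) j)))
        (λ w eq → let (j , eq′) = fixer-complete (P.to x) (I.to w) (action-fixes⁻ {w} eq) in j , trans (cong I.from eq′) (I.strictlyInverseʳ w)) ⟩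
      r ∎
      where
      open ≡.≡-Reasoning
      fixes? : Decidable₁ {A = Permutation′ n} (λ σ → σ ⟨$⟩ʳ x ≡ x)
      fixes? σ = (σ ⟨$⟩ʳ x) Fin.≟ x

  code-IPC : IsIPC r n code
  code-IPC = code-distance , code-idempotent , code-fixers

-- Rerouting one point of a map through `∞`.

module _ {A : Set} (_≟_ : DecidableEquality A) where

  pattern ∞ = inj₂ tt

  extend : (A → A) → A → A ⊎ ⊤ → A ⊎ ⊤
  extend f a ∞ = inj₁ (f a)
  extend f a (inj₁ x) with x ≟ a
  ... | yes _ = ∞
  ... | no  _ = inj₁ (f x)

  extend-injective : ∀ {f a} → Injective _≡_ _≡_ f → Injective _≡_ _≡_ (extend f a)
  extend-injective {f} {a} inj {∞}      {∞}      eq = refl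
  extend-injective {f} {a} inj {∞}      {inj₁ y} eq with y ≟ a
  ... | no y≢a = ⊥-elim (y≢a (sym (inj (inj₁-injective eq))))
  extend-injective {f} {a} inj {inj₁ x} {∞}      eq with x ≟ a
  ... | no x≢a = ⊥-elim (x≢a (inj (inj₁-injective eq)))
  extend-injective {f} {a} inj {inj₁ x} {inj₁ y} eq with x ≟ a | y ≟ a
  ... | yes x≡a | yes y≡a = cong inj₁ (trans x≡a (sym y≡a))
  ... | no _    | no _    = cong inj₁ (inj (inj₁-injective eq))

  extend-≢ : ∀ {f a x} → x ≢ a → extend f a (inj₁ x) ≡ inj₁ (f x)
  extend-≢ {f} {a} {x} x≢a with x ≟ a
  ... | yes x≡a = ⊥-elim (x≢a x≡a)
  ... | no _    = refl

  -- If just one of the maps reroutes `x`, the two values lie in different summands, so the mixed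
  -- cases are empty.
  extend-agree : ∀ {f a g b} z → extend f a z ≡ extend g b z →
    (z ≡ ∞ × f a ≡ g b) ⊎ (z ≡ inj₁ a × a ≡ b) ⊎ ∃ λ x → z ≡ inj₁ x × f x ≡ g x
  extend-agree ∞ eq = inj₁ (refl , inj₁-injective eq)
  extend-agree {a = a} {b = b} (inj₁ x) eq with x ≟ a | x ≟ b
  ... | yes x≡a | yes x≡b = inj₂ (inj₁ (cong inj₁ x≡a , trans (sym x≡a) x≡b))
  ... | no _    | no _    = inj₂ (inj₂ (x , refl , inj₁-injective eq))

  -- The map on the right fixes `∞` and sends nothing else there, whereas `extend f a` moves `∞`
  -- away and sends `a` there. Agreement thus avoids both points.
  extend-agree-map : ∀ {f a g} z → extend f a z ≡ Sum.map g id z → ∃ λ x → z ≡ inj₁ x × f x ≡ g x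
  extend-agree-map {a = a} (inj₁ x) eq with x ≟ a
  ... | no _ = x , refl , inj₁-injective eq

  extend-fixed : ∀ {f a} z → extend f a z ≡ z → ∃ λ x → z ≡ inj₁ x × f x ≡ x
  extend-fixed {a = a} (inj₁ x) eq with x ≟ a
  ... | no _ = x , refl , inj₁-injective eq

-- The code over the affine plane `K × K` with `∞`.

module FieldCode (m : ℕ) (D : IntegralDomainOn (Fin (suc m))) where

  open IntegralDomainOn D
  open CommutativeRing commutativeRing using (_-_; ring; +-identityˡ; -‿inverseʳ; -‿inverseˡ)
  open import Algebra.Properties.Ring ring using (x∙y⁻¹≈ε⇒x≈y; +-cancelˡ; +-cancelʳ)
  open IntegerSolver commutativeRing

  K = Fin (suc m)

  -- y ↦ y (y + 1) takes the value 0 twice, so it is not onto.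
  non-value : ∃ λ d → ∀ y → y * (y + 1#) ≢ d
  non-value with Fin.all? (λ d → any? (λ y → (y * (y + 1#)) Fin.≟ d))
  ... | no ¬onto = let (d , miss) = Fin.¬∀⟶∃¬ _ _ (λ d → any? (λ y → (y * (y + 1#)) Fin.≟ d)) ¬onto in d , λ y eq → miss (y , eq)
  ... | yes onto = ⊥-elim (1≢0 (trans (sym (+-identityˡ 1#)) (trans (cong (_+ 1#) 0≡-1) (-‿inverseˡ 1#))))
    where
    section : K → K
    section = proj₁ ∘ onto
    section-injective : Injective _≡_ _≡_ section
    section-injective {a} {b} eq = trans (sym (proj₂ (onto a))) (trans (cong (λ y → y * (y + 1#)) eq) (proj₂ (onto b)))
    -- An injective section on a finite set is onto, hence a two-sided inverse; so `y ↦ y (y + 1)`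
    -- would be injective.
    section-value : ∀ y → section (y * (y + 1#)) ≡ y
    section-value y with injective⇒surjective section-injective y
    ... | a , refl = cong section (proj₂ (onto a))
    0≡-1 : 0# ≡ - 1#
    0≡-1 = trans (sym (section-value 0#)) (trans (cong section
      (solve 0 (con 0ℤ :* (con 0ℤ :+ con 1ℤ) := :- con 1ℤ :* (:- con 1ℤ :+ con 1ℤ)) refl)) (section-value (- 1#)))

  module _ (d : K) (avoids : ∀ y → y * (y + 1#) ≢ d) where

    private
      minus≡0 : ∀ {x y} → x ≡ y → x - y ≡ 0#
      minus≡0 {x} refl = -‿inverseʳ x

      cancel : ∀ {a} x y → a ≢ 0# → a * (x - y) ≡ 0# → x ≡ y
      cancel x y a≢0 eq with integral _ _ eq
      ... | inj₁ a≡0 = ⊥-elim (a≢0 a≡0)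
      ... | inj₂ e   = x∙y⁻¹≈ε⇒x≈y x y e

      s+1≢s : ∀ s → s + 1# ≢ s
      s+1≢s s eq = 1≢0 (trans (solve 2 (λ s o → o := (s :+ o) :- s) refl s 1#) (minus≡0 eq))

      +1-injective : ∀ {s t} → s + 1# ≡ t + 1# → s ≡ t
      +1-injective {s} {t} eq = x∙y⁻¹≈ε⇒x≈y s t (trans (solve 3 (λ s t o → s :- t := (s :+ o) :- (t :+ o)) refl s t 1#) (minus≡0 eq))

      _≟²_ : DecidableEquality (K × K)
      _≟²_ = ≡-dec Fin._≟_ Fin._≟_

      _⊕_ _⊖_ : K × K → K × K → K × K
      (a , b) ⊕ (a′ , b′) = a + a′ , b + b′
      (a , b) ⊖ (a′ , b′) = a - a′ , b - b′

      -- On the basis 1, θ with θ² = θ + d this is multiplication by s + θ.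
      linear : K → K × K → K × K
      linear s (u , v) = s * u + d * v , u + (s + 1#) * v

      affine : K → K × K → K × K → K × K
      affine s b x = linear s x ⊕ b

      -- The determinant of multiplication by `s + θ` is `s (s + 1) - d`, nonzero by the choice of
      -- `d`. Eliminating the first coordinate isolates it. Stated for differences, so that affine
      -- maps and displacements both reduce to it.
      linear-kernel : ∀ s {u v u′ v′} → s * (u - u′) + d * (v - v′) ≡ 0# → (u - u′) + (s + 1#) * (v - v′) ≡ 0# →
        (u , v) ≡ (u′ , v′)
      linear-kernel s {u} {v} {u′} {v′} eq₁ eq₂ = cong₂ _,_ u≡u′ v≡v′
        where
        v≡v′ : v ≡ v′
        v≡v′ = cancel v v′ (λ e → avoids s (x∙y⁻¹≈ε⇒x≈y _ _ e))
          (trans (solve 5 (λ s o d u v → (s :* (s :+ o) :- d) :* v := s :* (u :+ (s :+ o) :* v) :- (s :* u :+ d :* v)) refl s 1# d (u - u′) (v - v′))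
          (trans (cong₂ (λ a b → s * a - b) eq₂ eq₁) (solve 1 (λ s → s :* con 0ℤ :- con 0ℤ := con 0ℤ) refl s)))
        u≡u′ : u ≡ u′
        u≡u′ = x∙y⁻¹≈ε⇒x≈y u u′
          (trans (solve 3 (λ a c v → a := (a :+ c :* v) :- c :* v) refl (u - u′) (s + 1#) (v - v′))
          (trans (cong₂ (λ a b → a - (s + 1#) * b) eq₂ (minus≡0 v≡v′)) (solve 1 (λ c → con 0ℤ :- c :* con 0ℤ := con 0ℤ) refl (s + 1#))))

      affine-injective : ∀ s b → Injective _≡_ _≡_ (affine s b)
      affine-injective s (b₁ , b₂) {u , v} {u′ , v′} eq = linear-kernel s
        (trans (solve 7 (λ s d u v u′ v′ b → s :* (u :- u′) :+ d :* (v :- v′) := ((s :* u :+ d :* v) :+ b) :- ((s :* u′ :+ d :* v′) :+ b)) refl s d u v u′ v′ b₁)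
          (minus≡0 (cong proj₁ eq)))
        (trans (solve 6 (λ c u v u′ v′ b → (u :- u′) :+ c :* (v :- v′) := ((u :+ c :* v) :+ b) :- ((u′ :+ c :* v′) :+ b)) refl (s + 1#) u v u′ v′ b₂)
          (minus≡0 (cong proj₂ eq)))

      displacement : K → K × K → K × K → K × K
      displacement s b x = affine s b x ⊖ x

      -- Subtracting `x` turns the slope `s + θ` into `(s - 1) + θ`, which is again invertible.
      -- Hence an affine map has one fixed point and meets each translation once.
      displacement-injective : ∀ s b → Injective _≡_ _≡_ (displacement s b)
      displacement-injective s (b₁ , b₂) {u , v} {u′ , v′} eq = linear-kernel (s - 1#)
        (trans (solve 7 (λ s d u v u′ v′ b → (s :- con 1ℤ) :* (u :- u′) :+ d :* (v :- v′) :=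
                  (((s :* u :+ d :* v) :+ b) :- u) :- (((s :* u′ :+ d :* v′) :+ b) :- u′)) refl s d u v u′ v′ b₁)
          (minus≡0 (cong proj₁ eq)))
        (trans (solve 6 (λ s u v u′ v′ b → (u :- u′) :+ ((s :- con 1ℤ) :+ con 1ℤ) :* (v :- v′) :=
                  (((u :+ (s :+ con 1ℤ) :* v) :+ b) :- v) :- (((u′ :+ (s :+ con 1ℤ) :* v′) :+ b) :- v′)) refl s u v u′ v′ b₂)
          (minus≡0 (cong proj₂ eq)))

      affine-translation : ∀ s b t {x} → affine s b x ≡ x ⊕ t → displacement s b x ≡ t
      affine-translation s b (t₁ , t₂) {u , v} eq = trans (cong (_⊖ (u , v)) eq)
        (cong₂ _,_ (solve 2 (λ u t → (u :+ t) :- u := t) refl u t₁) (solve 2 (λ u t → (u :+ t) :- u := t) refl v t₂))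

      affine-fixed : ∀ s b {x} → affine s b x ≡ x → displacement s b x ≡ (0# , 0#)
      affine-fixed s b {u , v} eq = trans (cong (_⊖ (u , v)) eq) (cong₂ _,_ (-‿inverseʳ u) (-‿inverseʳ v))

      square : Fin (suc m ℕ.^ 2) ↔ (K × K)
      square = subst (λ n → Fin (suc m ℕ.* n) ↔ (K × K)) (sym (ℕ.*-identityʳ (suc m))) *↔×

      displacement≡0⇒fixed : ∀ s b x → displacement s b x ≡ (0# , 0#) → affine s b x ≡ x
      displacement≡0⇒fixed s b x eq = cong₂ _,_ (x∙y⁻¹≈ε⇒x≈y _ _ (cong proj₁ eq)) (x∙y⁻¹≈ε⇒x≈y _ _ (cong proj₂ eq))

      -- Abstract, so that type checking never unfolds the search over K × K.
      abstract
        affine-fixedPoint : ∀ s b → ∃ λ x → affine s b x ≡ x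
        affine-fixedPoint s b = let (x , eq) = finite-injective⇒surjective square (displacement-injective s b) (0# , 0#) in
          x , displacement≡0⇒fixed s b x eq

      slope-cancel : ∀ {c e} u u′ → c ≢ 0# → c * u + e ≡ 0# → c * u′ + e ≡ 0# → u ≡ u′
      slope-cancel {c} {e} u u′ c≢0 eq eq′ = cancel u u′ c≢0
        (trans (solve 4 (λ c e u u′ → c :* (u :- u′) := (c :* u :+ e) :- (c :* u′ :+ e)) refl c e u u′)
          (trans (cong₂ _-_ eq eq′) (-‿inverseʳ 0#)))

      -- The slopes differ by the scalar `s - s′` of `K`, so an agreement is a separate linear
      -- equation for each coordinate, with nonzero leading coefficient.
      affine-slopes : ∀ {s s′} b b′ {x y} → s ≢ s′ → affine s b x ≡ affine s′ b′ x → affine s b y ≡ affine s′ b′ y → x ≡ y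
      affine-slopes {s} {s′} (b₁ , b₂) (b₁′ , b₂′) {u , v} {u′ , v′} s≢s′ eq eq′ = cong₂ _,_
        (slope-cancel u u′ s-s′≢0 (first u v (cong proj₁ eq)) (first u′ v′ (cong proj₁ eq′)))
        (slope-cancel v v′ s-s′≢0 (second u v (cong proj₂ eq)) (second u′ v′ (cong proj₂ eq′)))
        where
        s-s′≢0 : s - s′ ≢ 0#
        s-s′≢0 e = s≢s′ (x∙y⁻¹≈ε⇒x≈y s s′ e)
        first : ∀ u v → (s * u + d * v) + b₁ ≡ (s′ * u + d * v) + b₁′ → (s - s′) * u + (b₁ - b₁′) ≡ 0#
        first u v eq = trans (solve 6 (λ s s′ w u b b′ → (s :- s′) :* u :+ (b :- b′) := ((s :* u :+ w) :+ b) :- ((s′ :* u :+ w) :+ b′))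
          refl s s′ (d * v) u b₁ b₁′) (minus≡0 eq)
        second : ∀ u v → (u + (s + 1#) * v) + b₂ ≡ (u + (s′ + 1#) * v) + b₂′ → (s - s′) * v + (b₂ - b₂′) ≡ 0#
        second u v eq = trans (solve 6 (λ s s′ u v b b′ → (s :- s′) :* v :+ (b :- b′) := ((u :+ (s :+ con 1ℤ) :* v) :+ b) :- ((u :+ (s′ :+ con 1ℤ) :* v) :+ b′))
          refl s s′ u v b₂ b₂′) (minus≡0 eq)

      ⊕-cancelˡ : ∀ x {b b′} → x ⊕ b ≡ x ⊕ b′ → b ≡ b′
      ⊕-cancelˡ (x₁ , x₂) eq = cong₂ _,_ (+-cancelˡ x₁ _ _ (cong proj₁ eq)) (+-cancelˡ x₂ _ _ (cong proj₂ eq))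

      affine-offset : ∀ s {b b′} x → affine s b x ≡ affine s b′ x → b ≡ b′
      affine-offset s x = ⊕-cancelˡ (linear s x)

      ⊕-⊖ : ∀ x y → x ⊕ (y ⊖ x) ≡ y
      ⊕-⊖ (a , b) (a′ , b′) = cong₂ _,_ (solve 2 (λ a a′ → a :+ (a′ :- a) := a′) refl a a′) (solve 2 (λ a a′ → a :+ (a′ :- a) := a′) refl b b′)

      -- The point on the line v = s that the affine map sends to the line v = s + 1.
      hole : K → K × K → K × K
      hole s (b₁ , b₂) = (s + 1#) - (s + 1#) * s - b₂ , s

      affine-hole : ∀ s b → proj₂ (affine s b (hole s b)) ≡ s + 1#
      affine-hole s (b₁ , b₂) = solve 3 (λ s c b → ((c :- c :* s :- b) :+ c :* s) :+ b := c) refl s (s + 1#) b₂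

      -- The hole moves from second coordinate `s` to `s + 1`. Rerouting it therefore leaves the
      -- affine fixed point intact.
      hole-not-fixed : ∀ s b {x} → affine s b x ≡ x → x ≢ hole s b
      hole-not-fixed s b eq refl = s+1≢s s (trans (sym (affine-hole s b)) (cong proj₂ eq))

      -- Slopes and translations are both indexed by the `m = q - 1` elements of `K*`, so that every
      -- finite symbol gets as many fixers as `∞`.
      nonzero : Fin m → K
      nonzero = punchIn 0#

      Point Index : Set
      Point = (K × K) ⊎ ⊤
      Index = (Fin m × (K × K)) ⊎ Fin m

      translate : K → K × K → K × K
      translate t x = x ⊕ (t , 0#)

      word : Index → Point → Point
      word (inj₁ (j , b)) = extend _≟²_ (affine (nonzero j) b) (hole (nonzero j) b)
      word (inj₂ j)       = Sum.map (translate (nonzero j)) id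

      translate-injective : ∀ t → Injective _≡_ _≡_ (translate t)
      translate-injective t {u , v} {u′ , v′} eq = cong₂ _,_ (+-cancelʳ t _ _ (cong proj₁ eq)) (+-cancelʳ 0# _ _ (cong proj₂ eq))

      word-injective : ∀ w → Injective _≡_ _≡_ (word w)
      word-injective (inj₁ (j , b)) = extend-injective _≟²_ (affine-injective (nonzero j) b)
      word-injective (inj₂ j) {inj₁ x} {inj₁ y} eq = cong inj₁ (translate-injective (nonzero j) (inj₁-injective eq))
      word-injective (inj₂ j) {∞}      {∞}      eq = refl

      -- An agreement is a finite point whose displacement is `(t , 0#)`, and displacements are
      -- injective.
      affine-meets-translate : ∀ s b t x y → extend _≟²_ (affine s b) (hole s b) x ≡ Sum.map (translate t) id x →
        extend _≟²_ (affine s b) (hole s b) y ≡ Sum.map (translate t) id y → x ≡ y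
      affine-meets-translate s b t x y eq eq′ with extend-agree-map _≟²_ x eq | extend-agree-map _≟²_ y eq′
      ... | x′ , refl , e | y′ , refl , e′ = cong inj₁ (displacement-injective s b
        (trans (affine-translation s b (t , 0#) e) (sym (affine-translation s b (t , 0#) e′))))

      -- Different offsets never agree at a point that is not rerouted. Agreement at `∞` means that
      -- the holes have equal images, agreement at a hole that the holes coincide; together they
      -- would give `b ≡ b′`.
      same-slope : ∀ s {b b′} x y → b ≢ b′ →
        extend _≟²_ (affine s b) (hole s b) x ≡ extend _≟²_ (affine s b′) (hole s b′) x →
        extend _≟²_ (affine s b) (hole s b) y ≡ extend _≟²_ (affine s b′) (hole s b′) y → x ≡ y
      same-slope s {b} {b′} x y b≢b′ eq eq′ with extend-agree _≟²_ x eq | extend-agree _≟²_ y eq′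
      ... | inj₁ (refl , _)        | inj₁ (refl , _)        = refl
      ... | inj₂ (inj₁ (refl , _)) | inj₂ (inj₁ (refl , _)) = refl
      ... | inj₁ (_ , e)           | inj₂ (inj₁ (_ , e′))   = ⊥-elim (b≢b′ (affine-offset s (hole s b) (trans e (cong (affine s b′) (sym e′)))))
      ... | inj₂ (inj₁ (_ , e′))   | inj₁ (_ , e)           = ⊥-elim (b≢b′ (affine-offset s (hole s b) (trans e (cong (affine s b′) (sym e′)))))
      ... | inj₂ (inj₂ (z , _ , e)) | _                     = ⊥-elim (b≢b′ (affine-offset s z e))
      ... | inj₁ _        | inj₂ (inj₂ (z , _ , e))         = ⊥-elim (b≢b′ (affine-offset s z e))
      ... | inj₂ (inj₁ _) | inj₂ (inj₂ (z , _ , e))         = ⊥-elim (b≢b′ (affine-offset s z e))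

      -- Agreement at `∞` would equate the second coordinates `s + 1` and `s′ + 1` of the images of
      -- the holes, and a common hole would equate `s` and `s′`.
      distinct-slopes-agree : ∀ {s s′} b b′ x → s ≢ s′ →
        extend _≟²_ (affine s b) (hole s b) x ≡ extend _≟²_ (affine s′ b′) (hole s′ b′) x →
        ∃ λ z → x ≡ inj₁ z × affine s b z ≡ affine s′ b′ z
      distinct-slopes-agree {s} {s′} b b′ x s≢s′ eq with extend-agree _≟²_ x eq
      ... | inj₁ (_ , e)        = ⊥-elim (s≢s′ (+1-injective (trans (sym (affine-hole s b)) (trans (cong proj₂ e) (affine-hole s′ b′)))))
      ... | inj₂ (inj₁ (_ , e)) = ⊥-elim (s≢s′ (cong proj₂ e))
      ... | inj₂ (inj₂ found)   = found

      distinct-slopes : ∀ {s s′} b b′ x y → s ≢ s′ →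
        extend _≟²_ (affine s b) (hole s b) x ≡ extend _≟²_ (affine s′ b′) (hole s′ b′) x →
        extend _≟²_ (affine s b) (hole s b) y ≡ extend _≟²_ (affine s′ b′) (hole s′ b′) y → x ≡ y
      distinct-slopes b b′ x y s≢s′ eq eq′ with distinct-slopes-agree b b′ x s≢s′ eq | distinct-slopes-agree b b′ y s≢s′ eq′
      ... | z , refl , e | z′ , refl , e′ = cong inj₁ (affine-slopes b b′ s≢s′ e e′)

      agree-once : ∀ {v w} → v ≢ w → ∀ {x y} → word v x ≡ word w x → word v y ≡ word w y → x ≡ y
      agree-once {inj₁ (j , b)} {inj₁ (j′ , b′)} v≢w {x} {y} eq eq′ with j Fin.≟ j′
      ... | yes refl = same-slope (nonzero j) x y (λ { refl → v≢w refl }) eq eq′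
      ... | no j≢j′  = distinct-slopes b b′ x y (j≢j′ ∘ punchIn-injective 0# j j′) eq eq′
      agree-once {inj₁ (j , b)} {inj₂ i} v≢w {x} {y} eq eq′ = affine-meets-translate (nonzero j) b (nonzero i) x y eq eq′
      agree-once {inj₂ i} {inj₁ (j , b)} v≢w {x} {y} eq eq′ = affine-meets-translate (nonzero j) b (nonzero i) x y (sym eq) (sym eq′)
      -- Different translations agree only at `∞`, so a finite agreement is contradictory.
      agree-once {inj₂ i} {inj₂ j} v≢w {inj₁ x} {y} eq eq′ =
        ⊥-elim (v≢w (cong inj₂ (punchIn-injective 0# i j (cong proj₁ (⊕-cancelˡ x (inj₁-injective eq))))))
      agree-once {inj₂ i} {inj₂ j} v≢w {∞} {inj₁ y} eq eq′ =
        ⊥-elim (v≢w (cong inj₂ (punchIn-injective 0# i j (cong proj₁ (⊕-cancelˡ y (inj₁-injective eq′))))))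
      agree-once {inj₂ i} {inj₂ j} v≢w {∞} {∞} eq eq′ = refl

      translate-moves : ∀ j x → translate (nonzero j) x ≢ x
      translate-moves j (u , v) eq = punchInᵢ≢i 0# j
        (trans (solve 2 (λ u t → t := (u :+ t) :- u) refl u (nonzero j)) (minus≡0 (cong proj₁ eq)))

      fixed-point : ∀ w → ∃ λ x → word w x ≡ x × (∀ y → word w y ≡ y → x ≡ y)
      fixed-point (inj₁ (j , b)) with affine-fixedPoint (nonzero j) b
      ... | x , eq = inj₁ x , trans (extend-≢ _≟²_ (hole-not-fixed (nonzero j) b eq)) (cong inj₁ eq) , only
        where
        only : ∀ y → word (inj₁ (j , b)) y ≡ y → inj₁ x ≡ y
        only y e with extend-fixed _≟²_ y e
        ... | z , refl , e′ = cong inj₁ (displacement-injective (nonzero j) b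
          (trans (affine-fixed (nonzero j) b eq) (sym (affine-fixed (nonzero j) b e′))))
      fixed-point (inj₂ j) = ∞ , refl , only
        where
        only : ∀ y → word (inj₂ j) y ≡ y → ∞ ≡ y
        only (inj₁ x) e = ⊥-elim (translate-moves j x (inj₁-injective e))
        only ∞        e = refl

      fixer : Point → Fin m → Index
      fixer (inj₁ x) j = inj₁ (j , x ⊖ linear (nonzero j) x)
      fixer ∞        j = inj₂ j

      fixer-injective : ∀ x → Injective _≡_ _≡_ (fixer x)
      fixer-injective (inj₁ x) eq = cong proj₁ (inj₁-injective eq)
      fixer-injective ∞        eq = inj₂-injective eq

      fixer-fixes : ∀ x j → word (fixer x j) x ≡ x
      fixer-fixes (inj₁ x) j = trans (extend-≢ _≟²_ (hole-not-fixed (nonzero j) _ fixed)) (cong inj₁ fixed)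
        where fixed = ⊕-⊖ (linear (nonzero j) x) x
      fixer-fixes ∞        j = refl

      fixer-complete : ∀ x w → word w x ≡ x → ∃ λ j → fixer x j ≡ w
      fixer-complete (inj₁ x) (inj₁ (j , b)) eq with extend-fixed _≟²_ (inj₁ x) eq
      ... | _ , refl , e = j , cong (λ c → inj₁ (j , c)) (⊕-cancelˡ (linear (nonzero j) x) (trans (⊕-⊖ (linear (nonzero j) x) x) (sym e)))
      fixer-complete (inj₁ x) (inj₂ j) eq = ⊥-elim (translate-moves j x (inj₁-injective eq))
      fixer-complete ∞        (inj₂ j) eq = j , refl

      point : Fin (suc m ℕ.^ 2 ℕ.+ 1) ↔ Point
      point = ↔-trans +↔⊎ (square ⊎-↔ 1↔⊤)

      index : Fin (m ℕ.* suc m ℕ.^ 2 ℕ.+ m) ↔ Index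
      index = ↔-trans +↔⊎ (↔-trans *↔× (↔-refl ×-↔ square) ⊎-↔ ↔-refl)

    codeFromNonValue : Σ (List (Permutation′ (suc m ℕ.^ 2 ℕ.+ 1))) (IsIPC m (suc m ℕ.^ 2 ℕ.+ 1))
    codeFromNonValue = code , code-IPC
      where open Code point index word word-injective agree-once fixed-point fixer fixer-injective fixer-fixes fixer-complete

  fieldCode : Σ (List (Permutation′ (suc m ℕ.^ 2 ℕ.+ 1))) (IsIPC m (suc m ℕ.^ 2 ℕ.+ 1))
  fieldCode = let (d , avoids) = non-value in codeFromNonValue d avoids

-- The code for every prime power.

open import Data.Nat.Base using (_+_; _^_)

code-from-field : ∀ {q m} → q ≡ suc m → IntegralDomainOn (Fin q) →
  Σ (List (Permutation′ (q ^ 2 + 1))) (IsIPC (q ∸ 1) (q ^ 2 + 1))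
code-from-field {m = m} refl K = FieldCode.fieldCode m K

theorem4p1 : ∀ (q : ℕ) → IsPrimePower q →
    Σ (List (Permutation′ (q ^ 2 + 1))) (λ C → IsIPC (q ∸ 1) (q ^ 2 + 1) C)
theorem4p1 q (p , k , pr , 0<k , refl) = code-from-field q≡2+m (galoisField p pr k (q ∸ 2) 0<k q≡2+m)
  where
  -- A positive power of a prime is at least `2`. The offset `2` makes `N = q - 1` in the cyclic
  -- algebra and gives the code `1 + (q ∸ 2)` nonzero field elements.
  q≡2+m : q ≡ 2 + (q ∸ 2)
  q≡2+m = sym (ℕ.m+[n∸m]≡n (prime-power>1 pr 0<k))
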